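{- Let $\mathcal{F}$ be a finite $3$-uniform linear set system with maximum matching size $\nu=\nu(\mathcal{F})\geq 2$ and maximum degree $\Delta=\Delta(\mathcal{F})$. If $\Delta\geq \frac{23}{6}\nu\left(1+\frac{1}{\nu-1}\right)$, then $|\mathcal{F}|\leq \Delta\nu$.
   Context: A set system $\mathcal{F}$ on a vertex set $V$ is a collection of distinct subsets of $V$; it is $3$-uniform if every member has exactly $3$ elements, and linear if $|A\cap B|\leq 1$ for all distinct $A,B\in\mathcal{F}$. A matching is a collection of pairwise disjoint members of $\mathcal{F}$; $\nu(\mathcal{F})$ is the maximum size of a matching. For a vertex $x$, $\mathcal{F}_x=\{A\in\mathcal{F}: x\in A\}$ and $\Delta(\mathcal{F})=\max_x|\mathcal{F}_x|$. -}

module Defs where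

open import Data.Nat using (ℕ; _≤_)
open import Data.Fin using (Fin)
open import Data.Fin.Subset using (Subset; _∩_; ∣_∣; Empty; _∈_)
open import Data.Fin.Subset.Properties using (_∈?_)
open import Data.List using (List; length; filter)
open import Data.List.Membership.Propositional renaming (_∈_ to _∈ₗ_)
open import Data.List.Relation.Unary.All using (All)
open import Data.List.Relation.Unary.AllPairs using (AllPairs)
open import Data.List.Relation.Unary.Unique.Propositional using (Unique)
open import Data.Product using (_×_; Σ)
open import Relation.Binary.PropositionalEquality using (_≡_)

SetSystem : ℕ → Set
SetSystem n = List (Subset n)

IsSetSystem : ∀ {n} → SetSystem n → Set
IsSetSystem F = Unique F

ThreeUniform : ∀ {n} → SetSystem n → Set
ThreeUniform F = All (λ A → ∣ A ∣ ≡ 3) F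

-- |A ∩ B| ≤ 1 for distinct members (members are distinct list entries).
Linear : ∀ {n} → SetSystem n → Set
Linear F = AllPairs (λ A B → ∣ A ∩ B ∣ ≤ 1) F

IsMatching : ∀ {n} → SetSystem n → List (Subset n) → Set
IsMatching F M = Unique M × All (_∈ₗ F) M × AllPairs (λ A B → Empty (A ∩ B)) M

IsMatchingNumber : ∀ {n} → SetSystem n → ℕ → Set
IsMatchingNumber F k =
  Σ (List _) (λ M → IsMatching F M × length M ≡ k) ×
  (∀ M → IsMatching F M → length M ≤ k)

degree : ∀ {n} → SetSystem n → Fin n → ℕ
degree F x = length (filter (x ∈?_) F)

IsMaxDegree : ∀ {n} → SetSystem n → ℕ → Set
IsMaxDegree {n} F d = (∀ x → degree F x ≤ d) × Σ (Fin n) (λ x → degree F x ≡ d)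

{-# OPTIONS --safe #-}

-- Fix a maximum matching M. An edge is private at x if it meets ⋃M only in x, and a member of M is heavy
-- if it has a vertex x with at least 7 private edges (fix one such x), light otherwise; let there be t heavy
-- and s light members, t + s = ν. Few edges disturb a heavy member: it can always be traded for a private
-- edge at x avoiding them. So there are no p + 1 disjoint edges, avoiding all chosen vertices x, that meet
-- only p light members (as long as the edges have at most 4 vertices off the light members). Consequently:
-- * at most tΔ edges contain a chosen vertex, and every other edge meets a light member;
-- * the edges meeting light members only in one vertex, in A, pairwise intersect if they avoid the chosen
--   vertices, whence there are at most 6 + 2t of them;
-- * the edges with two vertices a ∈ A, b ∈ B in light members are pairs ab coloured by the third vertex,
--   without rainbow matchings of 3 pairs on A ∪ B or of 4 pairs on A ∪ B ∪ C. If A and B span at least 8 such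
--   pairs, then their colouring is essentially unique, and A and B together send at most 13 pairs to any C.
-- Weighing edges with two light vertices by 3 and, for each of their three pairs, edges with three light
-- vertices by 1, a pair of light members carries at most about 23 on average, which is where 23/6 comes from.
module Submission where

open import Defs
open import Data.Bool using (true; false; if_then_else_)
open import Data.Bool.Properties using () renaming (_≟_ to _≟ᵇ_)
open import Data.Empty using (⊥; ⊥-elim)
open import Data.Fin using (Fin; zero; suc)
open import Data.Fin.Patterns using (0F; 1F; 2F)
open import Data.Fin.Properties using () renaming (_≟_ to _≟ᶠ_; suc-injective to sucᶠ-injective)
open import Data.Fin.Subset using (Subset; _∩_; ∣_∣; _∈_; _∉_; inside; outside; Empty)
open import Data.Fin.Subset.Properties using (_∈?_; x∈p∩q⁺; x∈p∩q⁻; ∩-comm; nonempty?)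
open import Data.List using (List; []; _∷_; _++_; length; filter; map)
import Data.List.Membership.DecPropositional as DecMembership
open import Data.List.Membership.Propositional using (find; lose) renaming (_∈_ to _∈ₗ_; _∉_ to _∉ₗ_)
open import Data.List.Membership.Propositional.Properties using (∈-map⁺; ∈-map⁻; ∈-++⁺ˡ; ∈-++⁺ʳ; ∈-++⁻; ∈-filter⁺; ∈-filter⁻; ∈-∃++)
open import Data.List.Properties using (length-map; length-++)
open import Data.List.Relation.Binary.Permutation.Propositional using (_↭_; prep; swap; ↭-sym; ↭-trans; ↭⇒↭ₛ) renaming (refl to ↭-refl; trans to ↭-tr)
open import Data.List.Relation.Binary.Permutation.Propositional.Properties using (All-resp-↭; Any-resp-↭; ↭-length; shift)
import Data.List.Relation.Binary.Permutation.Setoid.Properties as SetoidPermutation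
open import Data.List.Relation.Unary.All as All using (All; []; _∷_)
open import Data.List.Relation.Unary.All.Properties as All using (¬All⇒Any¬)
open import Data.List.Relation.Unary.AllPairs as AllPairs using (AllPairs; []; _∷_)
open import Data.List.Relation.Unary.AllPairs.Properties as AllPairs using ()
open import Data.List.Relation.Unary.Any as Any using (Any; here; there)
import Data.List.Relation.Unary.Unique.DecPropositional as DecUnique
open import Data.List.Relation.Unary.Unique.Propositional using (Unique)
open import Data.List.Relation.Unary.Unique.Propositional.Properties as Unique using ()
open import Data.Nat using (ℕ; zero; suc; _+_; _*_; _∸_; _≤_; _<_; z≤n; s≤s; s≤s⁻¹; _≤?_; _≟_)
open import Data.Nat.Properties hiding (_≟_; _≤?_)
open import Data.Nat.Tactic.RingSolver using (solve-∀)
open import Data.Product using (∃; _×_; _,_; proj₁; proj₂)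
open import Data.Sum using (_⊎_; inj₁; inj₂)
open import Data.Vec using ([]; _∷_; here; there)
open import Data.Vec.Properties using (≡-dec)
open import Function using (_∘_; case_of_)
open import Relation.Binary.Definitions using (DecidableEquality)
open import Relation.Binary.PropositionalEquality
open import Relation.Nullary using (¬_; Dec; yes; no; does; contradiction)
open import Relation.Nullary.Decidable using (¬?; _×-dec_; _→-dec_; True; toWitness; decidable-stable)

private variable
  X Y : Set

-- Finite sums over lists.

∑ : List X → (X → ℕ) → ℕ
∑ []      f = 0
∑ (x ∷ L) f = f x + ∑ L f

syntax ∑ L (λ x → t) = ∑[ x ← L ] t

∑-mono : ∀ (L : List X) {f g : X → ℕ} → (∀ {x} → x ∈ₗ L → f x ≤ g x) → ∑ L f ≤ ∑ L g
∑-mono []      h = z≤n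
∑-mono (x ∷ L) h = +-mono-≤ (h (here refl)) (∑-mono L (h ∘ there))

∑-cong : ∀ (L : List X) {f g : X → ℕ} → (∀ x → f x ≡ g x) → ∑ L f ≡ ∑ L g
∑-cong []      h = refl
∑-cong (x ∷ L) h = cong₂ _+_ (h x) (∑-cong L h)

∑-+ : ∀ (L : List X) (f g : X → ℕ) → ∑[ x ← L ] (f x + g x) ≡ ∑ L f + ∑ L g
∑-+ []      f g = refl
∑-+ (x ∷ L) f g rewrite ∑-+ L f g = interchange (f x) (g x) (∑ L f) (∑ L g)
  where
  interchange : ∀ a b c d → (a + b) + (c + d) ≡ (a + c) + (b + d)
  interchange = solve-∀

∑-*ˡ : ∀ (L : List X) k (f : X → ℕ) → ∑[ x ← L ] (k * f x) ≡ k * ∑ L f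
∑-*ˡ []      k f = sym (*-zeroʳ k)
∑-*ˡ (x ∷ L) k f = trans (cong (k * f x +_) (∑-*ˡ L k f)) (sym (*-distribˡ-+ k (f x) (∑ L f)))

∑-zero : ∀ (L : List X) → ∑[ _ ← L ] 0 ≡ 0
∑-zero []      = refl
∑-zero (_ ∷ L) = ∑-zero L

∑-swap : ∀ (L : List X) (K : List Y) (f : X → Y → ℕ) →
         ∑[ x ← L ] ∑[ y ← K ] f x y ≡ ∑[ y ← K ] ∑[ x ← L ] f x y
∑-swap []      K f = sym (∑-zero K)
∑-swap (x ∷ L) K f = trans (cong (∑ K (f x) +_) (∑-swap L K f))
                           (sym (∑-+ K (f x) (λ y → ∑[ x ← L ] f x y)))

∑-++ : ∀ (L K : List X) (f : X → ℕ) → ∑ (L ++ K) f ≡ ∑ L f + ∑ K f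
∑-++ []      K f = refl
∑-++ (x ∷ L) K f = trans (cong (f x +_) (∑-++ L K f)) (sym (+-assoc (f x) (∑ L f) (∑ K f)))

∑-map : ∀ (h : Y → X) (L : List Y) (f : X → ℕ) → ∑ (map h L) f ≡ ∑ L (f ∘ h)
∑-map h []      f = refl
∑-map h (y ∷ L) f = cong (f (h y) +_) (∑-map h L f)

∑-≤-length : ∀ (L : List X) {f : X → ℕ} k → (∀ {x} → x ∈ₗ L → f x ≤ k) → ∑ L f ≤ length L * k
∑-≤-length []      k h = z≤n
∑-≤-length (x ∷ L) k h = +-mono-≤ (h (here refl)) (∑-≤-length L k (h ∘ there))

∑-1 : ∀ (L : List X) → ∑[ _ ← L ] 1 ≡ length L
∑-1 []      = refl
∑-1 (_ ∷ L) = cong suc (∑-1 L)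

term≤∑ : ∀ {L : List X} {x} (f : X → ℕ) → x ∈ₗ L → f x ≤ ∑ L f
term≤∑ {L = _ ∷ L} f (here refl) = m≤m+n _ (∑ L f)
term≤∑ {L = y ∷ L} f (there i)   = ≤-trans (term≤∑ f i) (m≤n+m (∑ L f) (f y))

∑-pos : ∀ (L : List X) (f : X → ℕ) → 0 < ∑ L f → ∃ λ x → x ∈ₗ L × 0 < f x
∑-pos (x ∷ L) f h with f x in eq
... | suc _ = x , here refl , subst (0 <_) (sym eq) (s≤s z≤n)
... | zero  with y , i , p ← ∑-pos L f h = y , there i , p

∑-vanish : ∀ (L : List X) {f : X → ℕ} → (∀ {x} → x ∈ₗ L → f x ≡ 0) → ∑ L f ≡ 0
∑-vanish []      h = refl
∑-vanish (x ∷ L) h = cong₂ _+_ (h (here refl)) (∑-vanish L (h ∘ there))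

-- Used wherever linearity or disjointness leaves at most one nonzero term, so that a bound on
-- single terms bounds the whole sum.
∑-single : ∀ {L : List X} {f : X → ℕ} {k} → Unique L →
           (∀ {x y} → x ∈ₗ L → y ∈ₗ L → 0 < f x → 0 < f y → x ≡ y) →
           (∀ {x} → x ∈ₗ L → f x ≤ k) → ∑ L f ≤ k
∑-single [] one bound = z≤n
∑-single {L = x ∷ L} {f} {k} (x∉L ∷ u) one bound with f x in eq
... | zero  = ∑-single u (λ i j → one (there i) (there j)) (bound ∘ there)
... | suc m = ≤-trans (≤-reflexive (trans (cong (suc m +_) others≡0) (+-identityʳ _)))
                      (subst (_≤ k) eq (bound (here refl)))
  where
  others : ∀ {y} → y ∈ₗ L → f y ≡ 0
  others {y} i with f y in eq′
  ... | zero  = refl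
  ... | suc _ = contradiction
                  (one (here refl) (there i) (subst (0 <_) (sym eq) (s≤s z≤n)) (subst (0 <_) (sym eq′) (s≤s z≤n)))
                  (All.lookup x∉L i)
  others≡0 : ∑ L f ≡ 0
  others≡0 = ∑-vanish L others

-- Indicators of decidable propositions, and counting with them.

𝟙 : ∀ {p} {P : Set p} → Dec P → ℕ
𝟙 d = if does d then 1 else 0

𝟙-yes : ∀ {p} {P : Set p} (d : Dec P) → P → 𝟙 d ≡ 1
𝟙-yes (yes _) _ = refl
𝟙-yes (no ¬p) p = contradiction p ¬p

𝟙-no : ∀ {p} {P : Set p} (d : Dec P) → ¬ P → 𝟙 d ≡ 0
𝟙-no (yes p) ¬p = contradiction p ¬p
𝟙-no (no _)  _  = refl

𝟙-true : ∀ {p} {P : Set p} (d : Dec P) → 0 < 𝟙 d → P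
𝟙-true (yes p) _ = p

𝟙-mono : ∀ {p q} {P : Set p} {Q : Set q} (d : Dec P) (d′ : Dec Q) → (P → Q) → 𝟙 d ≤ 𝟙 d′
𝟙-mono (yes p) d′ h = ≤-reflexive (sym (𝟙-yes d′ (h p)))
𝟙-mono (no _)  d′ h = z≤n

𝟙-≤ : ∀ {p} {P : Set p} (d : Dec P) {k} → (P → 1 ≤ k) → 𝟙 d ≤ k
𝟙-≤ (yes p) h = h p
𝟙-≤ (no _)  h = z≤n

𝟙≤1 : ∀ {p} {P : Set p} (d : Dec P) → 𝟙 d ≤ 1
𝟙≤1 (yes _) = s≤s z≤n
𝟙≤1 (no _)  = z≤n

0<*ˡ : ∀ m n → 0 < m * n → 0 < m
0<*ˡ (suc m) n _ = s≤s z≤n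

0<*ʳ : ∀ m n → 0 < m * n → 0 < n
0<*ʳ m n p = 0<*ˡ n m (subst (0 <_) (*-comm m n) p)

length-filter-∑ : ∀ {P : X → Set} (P? : ∀ x → Dec (P x)) (L : List X) →
                  length (filter P? L) ≡ ∑[ x ← L ] 𝟙 (P? x)
length-filter-∑ P? []      = refl
length-filter-∑ P? (x ∷ L) with does (P? x)
... | true  = cong suc (length-filter-∑ P? L)
... | false = length-filter-∑ P? L

module _ (_≟ₓ_ : DecidableEquality X) where

  count≡≤1 : ∀ {L : List X} → Unique L → ∀ y → ∑[ x ← L ] 𝟙 (x ≟ₓ y) ≤ 1
  count≡≤1 u y = ∑-single u (λ _ _ p q → trans (𝟙-true (_ ≟ₓ y) p) (sym (𝟙-true (_ ≟ₓ y) q)))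
                            (λ _ → 𝟙≤1 (_ ≟ₓ y))

  -- Each entry of `K` is charged to an equal entry of `L`; after swapping the sums, no entry of `L`
  -- is charged twice because `K` has no repetitions.
  ∑-⊆ : ∀ {K L : List X} (f : X → ℕ) → Unique K → (∀ {x} → x ∈ₗ K → x ∈ₗ L) → ∑ K f ≤ ∑ L f
  ∑-⊆ {K} {L} f u sub = begin
    ∑ K f                                       ≤⟨ ∑-mono K (λ {y} y∈K → begin
      f y                                          ≡⟨ *-identityʳ (f y) ⟨
      f y * 1                                      ≤⟨ *-monoʳ-≤ (f y) (≤-trans (≤-reflexive (sym (𝟙-yes (y ≟ₓ y) refl)))
                                                        (term≤∑ (λ x → 𝟙 (x ≟ₓ y)) (sub y∈K))) ⟩
      f y * ∑[ x ← L ] 𝟙 (x ≟ₓ y)                  ≡⟨ ∑-*ˡ L (f y) (λ x → 𝟙 (x ≟ₓ y)) ⟨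
      ∑[ x ← L ] (f y * 𝟙 (x ≟ₓ y))               ∎) ⟩
    ∑[ y ← K ] ∑[ x ← L ] (f y * 𝟙 (x ≟ₓ y))  ≡⟨ ∑-swap K L (λ y x → f y * 𝟙 (x ≟ₓ y)) ⟩
    ∑[ x ← L ] ∑[ y ← K ] (f y * 𝟙 (x ≟ₓ y))  ≤⟨ ∑-mono L (λ {x} _ → ∑-single u
                                                     (λ {y} {z} _ _ p q → trans (sym (eq p)) (eq q))
                                                     (λ {y} _ → bound x y)) ⟩
    ∑ L f                                       ∎
    where
    open ≤-Reasoning
    eq : ∀ {x y} → 0 < f y * 𝟙 (x ≟ₓ y) → x ≡ y
    eq {x} {y} p = 𝟙-true (x ≟ₓ y) (0<*ʳ (f y) _ p)
    bound : ∀ x y → f y * 𝟙 (x ≟ₓ y) ≤ f x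
    bound x y with x ≟ₓ y
    ... | yes refl = ≤-reflexive (*-identityʳ (f x))
    ... | no _     = ≤-trans (≤-reflexive (*-zeroʳ (f y))) z≤n

  length-⊆ : ∀ {K L : List X} → Unique K → (∀ {x} → x ∈ₗ K → x ∈ₗ L) → length K ≤ length L
  length-⊆ {K} {L} u sub = subst₂ _≤_ (∑-1 K) (∑-1 L) (∑-⊆ (λ _ → 1) u sub)

  -- Serves to discard one known vertex of an edge, which leaves a count of at most 2.
  ∑-≢ : ∀ {L : List X} {y} → y ∈ₗ L → suc (∑[ x ← L ] 𝟙 (¬? (x ≟ₓ y))) ≤ length L
  ∑-≢ {L} {y} y∈L = begin
    1 + ∑[ x ← L ] 𝟙 (¬? (x ≟ₓ y))
      ≤⟨ +-monoˡ-≤ (∑[ x ← L ] 𝟙 (¬? (x ≟ₓ y))) (≤-trans (≤-reflexive (sym (𝟙-yes (y ≟ₓ y) refl)))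
           (term≤∑ (λ x → 𝟙 (x ≟ₓ y)) y∈L)) ⟩
    ∑[ x ← L ] 𝟙 (x ≟ₓ y) + ∑[ x ← L ] 𝟙 (¬? (x ≟ₓ y))
      ≡⟨ ∑-+ L (λ x → 𝟙 (x ≟ₓ y)) (λ x → 𝟙 (¬? (x ≟ₓ y))) ⟨
    ∑[ x ← L ] (𝟙 (x ≟ₓ y) + 𝟙 (¬? (x ≟ₓ y)))
      ≡⟨ ∑-cong L (λ x → either x) ⟩
    ∑[ _ ← L ] 1
      ≡⟨ ∑-1 L ⟩
    length L ∎
    where
    open ≤-Reasoning
    either : ∀ x → 𝟙 (x ≟ₓ y) + 𝟙 (¬? (x ≟ₓ y)) ≡ 1
    either x with x ≟ₓ y
    ... | yes _ = refl
    ... | no _  = refl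

-- Permutations, triples and 3 × 3 arrays.

∑-↭ : ∀ {L K : List X} (f : X → ℕ) → L ↭ K → ∑ L f ≡ ∑ K f
∑-↭ f ↭-refl       = refl
∑-↭ f (prep x p)   = cong (f x +_) (∑-↭ f p)
∑-↭ {L = x ∷ y ∷ L} {K = _ ∷ _ ∷ K} f (swap x y p) =
  trans (cong (λ t → f x + (f y + t)) (∑-↭ f p)) (exchange (f x) (f y) (∑ K f))
  where
  exchange : ∀ a b c → a + (b + c) ≡ b + (a + c)
  exchange = solve-∀
∑-↭ f (↭-tr p q)   = trans (∑-↭ f p) (∑-↭ f q)

unique-↭ : ∀ {L K : List X} → L ↭ K → Unique L → Unique K
unique-↭ {X} p = SetoidPermutation.Unique-resp-↭ (setoid X) (↭⇒↭ₛ p)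

allPairs-↭ : ∀ {R : X → X → Set} {L K : List X} → (∀ {x y} → R x y → R y x) → L ↭ K → AllPairs R L → AllPairs R K
allPairs-↭ {X} {R = R} R-sym p =
  SetoidPermutation.AllPairs-resp-↭ (setoid X) R-sym ((λ { refl r → r }) , (λ { refl r → r })) (↭⇒↭ₛ p)

third-large : ∀ {k x y z} → x ≤ k → y ≤ k → 3 * k ≤ (x + y) + z → k ≤ z
third-large {k} {x} {y} {z} x≤k y≤k t = +-cancelˡ-≤ (k + k) k z (begin
  k + k + k    ≡⟨ triple k ⟩
  3 * k        ≤⟨ t ⟩
  x + y + z    ≤⟨ +-monoˡ-≤ z (+-mono-≤ x≤k y≤k) ⟩
  k + k + z    ∎)
  where
  open ≤-Reasoning
  triple : ∀ k → k + k + k ≡ 3 * k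
  triple = solve-∀

-- At most one of the three values falls short of `k`, and only by one; it is put last. With `k` = 3
-- this orders the rows, with `k` = 1 the columns, of a 3 × 3 array with at most one hole.
relabel : ∀ (L : List X) (h : X → ℕ) k → length L ≡ 3 → (∀ {x} → x ∈ₗ L → h x ≤ k) → 3 * k ≤ suc (∑ L h) →
          ∃ λ x → ∃ λ y → ∃ λ z → x ∷ y ∷ z ∷ [] ↭ L × k ≤ h x × k ≤ h y × k ≤ suc (h z)
relabel (x ∷ y ∷ z ∷ []) h k _ bound total with k ≤? h x | k ≤? h y
-- The spare unit is credited to the value below `k`, so both other values are forced up to `k`.
... | no x<k | _ = y , z , x , ↭-trans (prep y (swap z x ↭-refl)) (swap y x ↭-refl)
    , third-large (≰⇒> x<k) z≤k (≤-trans total (≤-reflexive (zx (h x) (h y) (h z))))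
    , third-large (≰⇒> x<k) y≤k (≤-trans total (≤-reflexive (yx (h x) (h y) (h z))))
    , third-large y≤k z≤k (≤-trans total (≤-reflexive (yz (h x) (h y) (h z))))
  where
  y≤k = bound (there (here refl))
  z≤k = bound (there (there (here refl)))
  zx : ∀ x y z → suc (x + (y + (z + 0))) ≡ suc x + z + y
  zx = solve-∀
  yx : ∀ x y z → suc (x + (y + (z + 0))) ≡ suc x + y + z
  yx = solve-∀
  yz : ∀ x y z → suc (x + (y + (z + 0))) ≡ y + z + suc x
  yz = solve-∀
... | yes k≤x | no y<k = x , z , y , prep x (swap z y ↭-refl) , k≤x
    , third-large x≤k (≰⇒> y<k) (≤-trans total (≤-reflexive (xy (h x) (h y) (h z))))
    , third-large x≤k z≤k (≤-trans total (≤-reflexive (xz (h x) (h y) (h z))))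
  where
  x≤k = bound (here refl)
  z≤k = bound (there (there (here refl)))
  xy : ∀ x y z → suc (x + (y + (z + 0))) ≡ x + suc y + z
  xy = solve-∀
  xz : ∀ x y z → suc (x + (y + (z + 0))) ≡ x + z + suc y
  xz = solve-∀
... | yes k≤x | yes k≤y = x , y , z , ↭-refl , k≤x , k≤y
    , third-large (bound (here refl)) (bound (there (here refl))) (≤-trans total (≤-reflexive (xy (h x) (h y) (h z))))
  where
  xy : ∀ x y z → suc (x + (y + (z + 0))) ≡ x + y + suc z
  xy = solve-∀

all-three : ∀ {P : Fin 3 → Set} (d : ∀ k → Dec (P k)) → 3 ≤ 𝟙 (d 0F) + (𝟙 (d 1F) + 𝟙 (d 2F)) → ∀ k → P k
all-three d h with d 0F | d 1F | d 2F
all-three d h                   | yes p | yes q | yes r = λ { 0F → p ; 1F → q ; 2F → r }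
all-three d (s≤s (s≤s ()))      | yes _ | yes _ | no _
all-three d (s≤s (s≤s ()))      | yes _ | no _  | yes _
all-three d (s≤s ())            | yes _ | no _  | no _
all-three d (s≤s (s≤s ()))      | no _  | yes _ | yes _
all-three d (s≤s ())            | no _  | yes _ | no _
all-three d (s≤s ())            | no _  | no _  | yes _
all-three d ()                  | no _  | no _  | no _

two-of-three : ∀ {P : Fin 3 → Set} (d : ∀ k → Dec (P k)) → 2 ≤ 𝟙 (d 0F) + (𝟙 (d 1F) + 𝟙 (d 2F)) →
               ∃ λ k → ∃ λ l → k ≢ l × P k × P l
two-of-three d h with d 0F | d 1F | d 2F
two-of-three d h        | yes p | yes q | _     = 0F , 1F , (λ ()) , p , q
two-of-three d h        | yes p | no _  | yes r = 0F , 2F , (λ ()) , p , r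
two-of-three d (s≤s ()) | yes _ | no _  | no _
two-of-three d h        | no _  | yes q | yes r = 1F , 2F , (λ ()) , q , r
two-of-three d (s≤s ()) | no _  | yes _ | no _
two-of-three d (s≤s ()) | no _  | no _  | yes _
two-of-three d ()       | no _  | no _  | no _

-- The cells of a 3 × 3 array other than its last one are coloured as
--   p q r
--   s t u
--   v w
-- and the last four hypotheses are about the transversals avoiding the last cell.
two-colourings : ∀ {p q r s t u v w : X} →
  p ≢ q → p ≢ r → q ≢ r → s ≢ t → s ≢ u → t ≢ u → v ≢ w →
  p ≢ s → p ≢ v → s ≢ v → q ≢ t → q ≢ w → t ≢ w → r ≢ u →
  r ≡ t ⊎ t ≡ v ⊎ r ≡ v → p ≡ u ⊎ u ≡ w ⊎ p ≡ w →
  q ≡ u ⊎ u ≡ v ⊎ q ≡ v → r ≡ s ⊎ s ≡ w ⊎ r ≡ w →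
  (t ≡ v × q ≡ u × p ≡ w × s ≡ r) ⊎ (t ≡ r × s ≡ w × p ≡ u × q ≡ v)
two-colourings pq pr qr st su tu vw ps pv sv qt qw tw ru = λ where
  (inj₂ (inj₂ refl)) _                  (inj₂ (inj₁ refl)) _                  → ⊥-elim (ru refl)
  (inj₂ (inj₂ refl)) _                  (inj₂ (inj₂ refl)) _                  → ⊥-elim (qr refl)
  (inj₂ (inj₂ refl)) _                  _                  (inj₁ refl)        → ⊥-elim (sv refl)
  (inj₂ (inj₂ refl)) _                  _                  (inj₂ (inj₂ refl)) → ⊥-elim (vw refl)
  (inj₂ (inj₂ refl)) (inj₁ refl)        (inj₁ refl)        _                  → ⊥-elim (pq refl)
  (inj₂ (inj₂ refl)) (inj₂ (inj₁ refl)) (inj₁ refl)        _                  → ⊥-elim (qw refl)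
  (inj₂ (inj₂ refl)) (inj₂ (inj₂ refl)) (inj₁ refl)        (inj₂ (inj₁ refl)) → ⊥-elim (ps refl)
  (inj₁ refl)        _                  _                  (inj₁ refl)        → ⊥-elim (st refl)
  (inj₁ refl)        _                  _                  (inj₂ (inj₂ refl)) → ⊥-elim (tw refl)
  (inj₁ refl)        (inj₂ (inj₁ refl)) _                  (inj₂ (inj₁ refl)) → ⊥-elim (su refl)
  (inj₁ refl)        (inj₂ (inj₂ refl)) _                  (inj₂ (inj₁ refl)) → ⊥-elim (ps refl)
  (inj₁ refl)        (inj₁ refl)        (inj₁ refl)        (inj₂ (inj₁ refl)) → ⊥-elim (pq refl)
  (inj₁ refl)        (inj₁ refl)        (inj₂ (inj₁ refl)) (inj₂ (inj₁ refl)) → ⊥-elim (pv refl)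
  (inj₁ refl)        (inj₁ refl)        (inj₂ (inj₂ refl)) (inj₂ (inj₁ refl)) → inj₂ (refl , refl , refl , refl)
  (inj₂ (inj₁ refl)) _                  (inj₂ (inj₁ refl)) _                  → ⊥-elim (tu refl)
  (inj₂ (inj₁ refl)) _                  (inj₂ (inj₂ refl)) _                  → ⊥-elim (qt refl)
  (inj₂ (inj₁ refl)) (inj₁ refl)        (inj₁ refl)        _                  → ⊥-elim (pq refl)
  (inj₂ (inj₁ refl)) (inj₂ (inj₁ refl)) (inj₁ refl)        _                  → ⊥-elim (qw refl)
  (inj₂ (inj₁ refl)) (inj₂ (inj₂ refl)) (inj₁ refl)        (inj₂ (inj₁ refl)) → ⊥-elim (ps refl)
  (inj₂ (inj₁ refl)) (inj₂ (inj₂ refl)) (inj₁ refl)        (inj₂ (inj₂ refl)) → ⊥-elim (pr refl)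
  (inj₂ (inj₁ refl)) (inj₂ (inj₂ refl)) (inj₁ refl)        (inj₁ refl)        → inj₁ (refl , refl , refl , refl)

+-mono₆-≤ : ∀ {a b c d e f a′ b′ c′ d′ e′ f′} → a ≤ a′ → b ≤ b′ → c ≤ c′ → d ≤ d′ → e ≤ e′ → f ≤ f′ →
      (a + (b + c)) + (d + (e + f)) ≤ (a′ + (b′ + c′)) + (d′ + (e′ + f′))
+-mono₆-≤ a b c d e f = +-mono-≤ (+-mono-≤ a (+-mono-≤ b c)) (+-mono-≤ d (+-mono-≤ e f))

-- The six numbers will be those of the pairs that the vertices of A and B send to C. Splitting on
-- which of them equal 3, the caps add up to 12 or 13 in every case; with no 3 found except possibly
-- `b₂`, they are five times 2 and once 3.
degrees≤13 : ∀ {a₀ a₁ a₂ b₀ b₁ b₂} →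
  a₀ ≤ 3 → a₁ ≤ 3 → a₂ ≤ 3 → b₀ ≤ 3 → b₁ ≤ 3 → b₂ ≤ 3 →
  (3 ≤ a₀ → b₀ ≤ 1) → (3 ≤ a₀ → b₂ ≤ 1) → (3 ≤ a₁ → b₁ ≤ 1) → (3 ≤ a₁ → b₂ ≤ 1) →
  (3 ≤ b₁ → a₀ ≤ 1) → (3 ≤ b₀ → a₁ ≤ 1) → (3 ≤ b₀ → a₂ ≤ 1) → (3 ≤ b₁ → a₂ ≤ 1) →
  (3 ≤ a₂ → b₂ ≤ 2) →
  (a₀ + (a₁ + a₂)) + (b₀ + (b₁ + b₂)) ≤ 13
degrees≤13 {a₀} {a₁} {a₂} {b₀} {b₁} {b₂} A₀ A₁ A₂ B₀ B₁ B₂ h₀₀ h₀₂ h₁₁ h₁₂ k₁₀ k₀₁ k₀₂ k₁₂ h₂₂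
  with 3 ≤? a₀ | 3 ≤? a₁ | 3 ≤? b₀ | 3 ≤? b₁ | 3 ≤? a₂
... | yes p | yes q | _     | _     | _     = ≤-trans (+-mono₆-≤ A₀ A₁ A₂ (h₀₀ p) (h₁₁ q) (h₀₂ p)) (n≤1+n 12)
... | yes p | no q  | _     | _     | _     = +-mono₆-≤ A₀ (≮⇒≥ q) A₂ (h₀₀ p) B₁ (h₀₂ p)
... | no p  | yes q | _     | _     | _     = +-mono₆-≤ (≮⇒≥ p) A₁ A₂ B₀ (h₁₁ q) (h₁₂ q)
... | no p  | no q  | yes r | _     | _     = +-mono₆-≤ (≮⇒≥ p) (k₀₁ r) (k₀₂ r) B₀ B₁ B₂
... | no p  | no q  | no r  | yes s | _     = ≤-trans (+-mono₆-≤ (k₁₀ s) (≮⇒≥ q) (k₁₂ s) (≮⇒≥ r) B₁ B₂) (n≤1+n 12)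
... | no p  | no q  | no r  | no s  | yes t = +-mono₆-≤ (≮⇒≥ p) (≮⇒≥ q) A₂ (≮⇒≥ r) (≮⇒≥ s) (h₂₂ t)
... | no p  | no q  | no r  | no s  | no t  = +-mono₆-≤ (≮⇒≥ p) (≮⇒≥ q) (≮⇒≥ t) (≮⇒≥ r) (≮⇒≥ s) B₂

allPairs-++⁻ : ∀ {R : X → X → Set} L {K} → AllPairs R (L ++ K) →
               AllPairs R L × AllPairs R K × All (λ x → All (R x) K) L
allPairs-++⁻ []      rs       = [] , rs , []
allPairs-++⁻ (x ∷ L) (r ∷ rs) with l , k , lk ← allPairs-++⁻ L rs =
  All.++⁻ˡ L r ∷ l , k , All.++⁻ʳ L r ∷ lk

private variable
  n : ℕ

-- Subsets as lists of vertices; intersections and disjointness.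

_≟ˢ_ : DecidableEquality (Subset n)
_≟ˢ_ = ≡-dec _≟ᵇ_

χ : Subset n → Fin n → ℕ
χ A x = 𝟙 (x ∈? A)

elems : Subset n → List (Fin n)
elems []            = []
elems (inside  ∷ A) = zero ∷ map suc (elems A)
elems (outside ∷ A) = map suc (elems A)

∈-elems⁺ : ∀ {A : Subset n} {x} → x ∈ A → x ∈ₗ elems A
∈-elems⁺ {A = inside  ∷ A} here      = here refl
∈-elems⁺ {A = inside  ∷ A} (there i) = there (∈-map⁺ suc (∈-elems⁺ i))
∈-elems⁺ {A = outside ∷ A} (there i) = ∈-map⁺ suc (∈-elems⁺ i)

∈-elems⁻ : ∀ {A : Subset n} {x} → x ∈ₗ elems A → x ∈ A
∈-elems⁻ {A = inside  ∷ A} (here refl) = here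
∈-elems⁻ {A = inside  ∷ A} (there i) with _ , j , refl ← ∈-map⁻ suc i = there (∈-elems⁻ j)
∈-elems⁻ {A = outside ∷ A} i         with _ , j , refl ← ∈-map⁻ suc i = there (∈-elems⁻ j)

elems-unique : (A : Subset n) → Unique (elems A)
elems-unique []            = []
elems-unique (inside  ∷ A) = All.map⁺ (All.universal (λ _ ()) (elems A)) ∷ Unique.map⁺ sucᶠ-injective (elems-unique A)
elems-unique (outside ∷ A) = Unique.map⁺ sucᶠ-injective (elems-unique A)

length-elems : (A : Subset n) → length (elems A) ≡ ∣ A ∣
length-elems []            = refl
length-elems (inside  ∷ A) = cong suc (trans (length-map suc (elems A)) (length-elems A))
length-elems (outside ∷ A) = trans (length-map suc (elems A)) (length-elems A)

infix 8 _#_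
-- The size of the intersection, by `#≡∣∩∣`; written as a sum over vertices so that it can be
-- exchanged with sums over edges and members.
_#_ : Subset n → Subset n → ℕ
A # e = ∑ (elems A) (χ e)

#≡∣∩∣ : (A e : Subset n) → A # e ≡ ∣ A ∩ e ∣
#≡∣∩∣ []            []            = refl
#≡∣∩∣ (inside  ∷ A) (inside  ∷ e) = cong suc (trans (∑-map suc (elems A) (χ (inside ∷ e))) (#≡∣∩∣ A e))
#≡∣∩∣ (inside  ∷ A) (outside ∷ e) = trans (∑-map suc (elems A) (χ (outside ∷ e))) (#≡∣∩∣ A e)
#≡∣∩∣ (outside ∷ A) (b       ∷ e) = trans (∑-map suc (elems A) (χ (b ∷ e))) (#≡∣∩∣ A e)

#-comm : (A e : Subset n) → A # e ≡ e # A
#-comm A e = trans (#≡∣∩∣ A e) (trans (cong ∣_∣ (∩-comm A e)) (sym (#≡∣∩∣ e A)))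

Disjoint : Subset n → Subset n → Set
Disjoint A B = ∀ {x} → x ∈ A → x ∈ B → ⊥

empty⇒disjoint : ∀ {A B : Subset n} → Empty (A ∩ B) → Disjoint A B
empty⇒disjoint ∅ i j = ∅ (_ , x∈p∩q⁺ (i , j))

meet? : (A B : Subset n) → (∃ λ x → x ∈ A × x ∈ B) ⊎ Disjoint A B
meet? A B with nonempty? (A ∩ B)
... | yes (x , i) = inj₁ (x , x∈p∩q⁻ A B i)
... | no ∅        = inj₂ (empty⇒disjoint ∅)

disjoint-sym : ∀ {A B : Subset n} → Disjoint A B → Disjoint B A
disjoint-sym d i j = d j i

disjoint⇒#≡0 : ∀ {A B : Subset n} → Disjoint A B → A # B ≡ 0
disjoint⇒#≡0 {A = A} {B} d = ∑-vanish (elems A) λ {x} i → 𝟙-no (x ∈? B) (d (∈-elems⁻ i))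

∈⇒0<# : ∀ {A B : Subset n} {x} → x ∈ A → x ∈ B → 0 < A # B
∈⇒0<# {A = A} {B} {x} i j = ≤-trans (≤-reflexive (sym (𝟙-yes (x ∈? B) j))) (term≤∑ (χ B) (∈-elems⁺ i))

#≡0⇒disjoint : ∀ {A B : Subset n} → A # B ≡ 0 → Disjoint A B
#≡0⇒disjoint z i j = contradiction (subst (0 <_) z (∈⇒0<# i j)) λ ()

distinct-pair : ∀ {A : Subset n} {x y} → x ∈ A → y ∈ A → x ≢ y → 2 ≤ ∣ A ∣
distinct-pair {A = A} {x} {y} i j x≢y = subst (2 ≤_) (length-elems A)
  (length-⊆ _≟ᶠ_ {K = x ∷ y ∷ []} ((x≢y ∷ []) ∷ [] ∷ [])
    λ { (here refl) → ∈-elems⁺ i ; (there (here refl)) → ∈-elems⁺ j })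

disjoint? : (A B : Subset n) → Dec (Disjoint A B)
disjoint? A B with meet? A B
... | inj₁ (x , i , j) = no λ d → d i j
... | inj₂ d           = yes λ {x} → d

-- Edges of a linear 3-uniform system.

module Linear3Graph {n : ℕ} (F : SetSystem n)
  (F-unique : IsSetSystem F) (F-uniform : ThreeUniform F) (F-linear : Linear F) where

  private variable
    a b c v w x y z : Fin n
    A A′ e f q : Subset n

  allPairs-lookup : ∀ {L} → AllPairs (λ A B → ∣ A ∩ B ∣ ≤ 1) L → e ∈ₗ L → f ∈ₗ L → e ≢ f → ∣ e ∩ f ∣ ≤ 1
  allPairs-lookup (_ ∷ _)  (here refl) (here refl) e≢f = contradiction refl e≢f
  allPairs-lookup (r ∷ _)  (here refl) (there j)   e≢f = All.lookup r j
  allPairs-lookup {e} {f} (r ∷ _) (there i) (here refl) e≢f = subst (λ p → ∣ p ∣ ≤ 1) (∩-comm f e) (All.lookup r i)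
  allPairs-lookup (_ ∷ rs) (there i)   (there j)   e≢f = allPairs-lookup rs i j e≢f

  ∩≤1 : e ∈ₗ F → f ∈ₗ F → e ≢ f → ∣ e ∩ f ∣ ≤ 1
  ∩≤1 = allPairs-lookup F-linear

  edge-unique : e ∈ₗ F → f ∈ₗ F → x ≢ y → x ∈ e → y ∈ e → x ∈ f → y ∈ f → e ≡ f
  edge-unique {e} {f} e∈ f∈ x≢y xe ye xf yf with e ≟ˢ f
  ... | yes e≡f = e≡f
  ... | no e≢f  = contradiction (≤-trans (distinct-pair (x∈p∩q⁺ (xe , xf)) (x∈p∩q⁺ (ye , yf)) x≢y) (∩≤1 e∈ f∈ e≢f))
                                λ { (s≤s ()) }

  length-edge : e ∈ₗ F → length (elems e) ≡ 3
  length-edge {e} e∈ = trans (length-elems e) (All.lookup F-uniform e∈)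

  edge-nonempty : e ∈ₗ F → ∃ (_∈ e)
  edge-nonempty {e} e∈ with elems e in eq | length-edge e∈
  ... | x ∷ _ | _ = x , ∈-elems⁻ (subst (x ∈ₗ_) (sym eq) (here refl))

  -- An edge repeated in `Q` would be disjoint from itself, but edges are nonempty.
  disjoint⇒unique : ∀ {Q} → All (_∈ₗ F) Q → AllPairs Disjoint Q → Unique Q
  disjoint⇒unique []        []       = []
  disjoint⇒unique (e∈ ∷ es) (d ∷ ds) =
    All.map (λ { d refl → let x , i = edge-nonempty e∈ in d i i }) d ∷ disjoint⇒unique es ds

  matching : ∀ {Q} → All (_∈ₗ F) Q → AllPairs Disjoint Q → IsMatching F Q
  matching es ds = disjoint⇒unique es ds , es ,
    AllPairs.map (λ {A} {B} d (x , i) → let j , k = x∈p∩q⁻ A B i in d j k) ds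

  -- Private edges, and heavy and light members.

  -- `Covered` stands for the union of the given matching. As a parameter it fixes the private
  -- degrees before the matching is split into heavy and light members and reordered.
  module Partitioned (Covered : Fin n → Set) (covered? : ∀ x → Dec (Covered x)) where

    Private : Fin n → Subset n → Set
    Private x q = x ∈ q × All (λ v → Covered v → v ≡ x) (elems q)

    private? : ∀ x q → Dec (Private x q)
    private? x q = x ∈? q ×-dec All.all? (λ v → covered? v →-dec v ≟ᶠ x) (elems q)

    privateDegree : Fin n → ℕ
    privateDegree x = ∑[ q ← F ] 𝟙 (private? x q)

    outside# : Subset n → ℕ
    outside# e = ∑[ v ← elems e ] 𝟙 (¬? (covered? v))

    private-only : Private x q → v ∈ q → Covered v → v ≡ x
    private-only (_ , only) i = All.lookup only (∈-elems⁺ i)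

    private-outside : q ∈ₗ F → Covered x → Private x q → outside# q ≤ 2
    private-outside {q} {x} q∈ cov p = s≤s⁻¹ (begin
      suc (outside# q)                                ≤⟨ s≤s (∑-mono (elems q) λ {v} _ → bound v) ⟩
      suc (∑[ v ← elems q ] 𝟙 (¬? (v ≟ᶠ x)))          ≤⟨ ∑-≢ _≟ᶠ_ (∈-elems⁺ (proj₁ p)) ⟩
      length (elems q)                                ≡⟨ length-edge q∈ ⟩
      3                                               ∎)
      where
      open ≤-Reasoning
      bound : ∀ v → 𝟙 (¬? (covered? v)) ≤ 𝟙 (¬? (v ≟ᶠ x))
      bound v with v ≟ᶠ x
      ... | no _     = 𝟙≤1 (¬? (covered? v))
      ... | yes refl = ≤-reflexive (𝟙-no (¬? (covered? v)) (λ ¬c → ¬c cov))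

    -- Distinct private edges at x are disjoint outside x, so each uncovered vertex of Q spoils at most one of them.
    private-avoiding : ∀ Q → (∀ {q} → q ∈ₗ Q → x ∉ q) → ∑ Q outside# < privateDegree x →
                       Covered x → ∃ λ q → q ∈ₗ F × Private x q × All (Disjoint q) Q
    private-avoiding {x} Q x∉ few cov with Any.any? (λ q → private? x q ×-dec All.all? (disjoint? q) Q) F
    ... | yes found with q , q∈ , p , d ← find found = q , q∈ , p , d
    ... | no none = contradiction few (≤⇒≯ (begin
        ∑[ q ← F ] 𝟙 (private? x q)
          ≤⟨ ∑-mono F hit ⟩
        ∑[ q ← F ] ∑[ r ← Q ] ∑[ v ← elems r ] t q v
          ≡⟨ ∑-swap F Q (λ q r → ∑[ v ← elems r ] t q v) ⟩
        ∑[ r ← Q ] ∑[ q ← F ] ∑[ v ← elems r ] t q v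
          ≤⟨ ∑-mono Q (λ {r} _ → ≤-trans (≤-reflexive (∑-swap F (elems r) t)) (∑-mono (elems r) (λ {v} _ → once v))) ⟩
        ∑ Q outside# ∎))
      where
      open ≤-Reasoning
      t : Subset n → Fin n → ℕ
      t q v = 𝟙 (¬? (covered? v) ×-dec (private? x q ×-dec v ∈? q))
      once : ∀ v → ∑[ q ← F ] t q v ≤ 𝟙 (¬? (covered? v))
      once v = ∑-single F-unique
        (λ {q} {r} q∈ r∈ p p′ →
          let ¬c , (xq , _) , vq = 𝟙-true (¬? (covered? v) ×-dec (private? x q ×-dec v ∈? q)) p
              _  , (xr , _) , vr = 𝟙-true (¬? (covered? v) ×-dec (private? x r ×-dec v ∈? r)) p′
          in edge-unique q∈ r∈ (λ { refl → ¬c cov }) xq vq xr vr)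
        (λ {q} _ → 𝟙-mono (¬? (covered? v) ×-dec (private? x q ×-dec v ∈? q)) (¬? (covered? v)) proj₁)
      hit : ∀ {q} → q ∈ₗ F → 𝟙 (private? x q) ≤ ∑[ r ← Q ] ∑[ v ← elems r ] t q v
      hit {q} q∈ = 𝟙-≤ (private? x q) (λ p → meets p (¬All⇒Any¬ (disjoint? q) Q λ ds → none (lose q∈ (p , ds))))
        where
        meets : Private x q → Any (λ r → ¬ Disjoint q r) Q → 1 ≤ ∑[ r ← Q ] ∑[ v ← elems r ] t q v
        meets p ¬ds with find ¬ds
        ... | r , r∈ , ¬d with meet? q r
        ... | inj₂ d = contradiction (λ {x} → d {x}) ¬d
        ... | inj₁ (v , vq , vr) = begin
          1                              ≡⟨ 𝟙-yes (¬? (covered? v) ×-dec (private? x q ×-dec v ∈? q)) (¬c , p , vq) ⟨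
          t q v                          ≤⟨ term≤∑ (t q) (∈-elems⁺ vr) ⟩
          ∑[ v ← elems r ] t q v         ≤⟨ term≤∑ (λ r → ∑[ v ← elems r ] t q v) r∈ ⟩
          ∑[ r ← Q ] ∑[ v ← elems r ] t q v ∎
          where
          -- The only covered vertex of a private edge at `x` is `x` itself, which `Q` avoids.
          ¬c : ¬ Covered v
          ¬c c = x∉ r∈ (subst (_∈ r) (private-only p vq c) vr)

    -- The threshold 7 is what `trade` consumes: when a heavy member has to be replaced, at most 6
    -- uncovered vertices can spoil private edges at its chosen vertex.
    partition : ∀ L → ∃ λ B → ∃ λ S → L ↭ map proj₁ B ++ S ×
                All (λ (A , x) → x ∈ A × 7 ≤ privateDegree x) B × All (λ A → ∀ {x} → x ∈ A → privateDegree x ≤ 6) S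
    partition [] = [] , [] , ↭-refl , [] , []
    partition (A ∷ L) with partition L | Any.any? (λ x → 7 ≤? privateDegree x) (elems A)
    ... | B , S , p , heavy , light | yes some with x , x∈A , h ← find some =
      (A , x) ∷ B , S , prep A p , (∈-elems⁻ x∈A , h) ∷ heavy , light
    ... | B , S , p , heavy , light | no none =
      B , A ∷ S , ↭-trans (prep A p) (↭-sym (shift A (map proj₁ B) S)) , heavy , (λ i → ≮⇒≥ λ h → none (lose (∈-elems⁺ i) h)) ∷ light

    -- B lists the heavy members of the matching with their chosen vertices, S the light members.
    module Extremal
      (B : List (Subset n × Fin n)) (S : List (Subset n))
      (M⊆F : All (_∈ₗ F) (map proj₁ B ++ S)) (M-disjoint : AllPairs Disjoint (map proj₁ B ++ S))
      (covered⇒∈ : ∀ {v} → Covered v → Any (v ∈_) (map proj₁ B ++ S))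
      (∈⇒covered : ∀ {A v} → A ∈ₗ map proj₁ B ++ S → v ∈ A → Covered v)
      (B-heavy : All (λ (A , x) → x ∈ A × 7 ≤ privateDegree x) B)
      (S-light : All (λ A → ∀ {x} → x ∈ A → privateDegree x ≤ 6) S)
      (maximum : ∀ Q → All (_∈ₗ F) Q → AllPairs Disjoint Q → length Q ≤ length B + length S) where

      -- The ordered matching, and trades of its heavy members.

      M : List (Subset n)
      M = map proj₁ B ++ S

      B⊆M : ∀ {p} → p ∈ₗ B → proj₁ p ∈ₗ M
      B⊆M i = ∈-++⁺ˡ (∈-map⁺ proj₁ i)

      S⊆M : A ∈ₗ S → A ∈ₗ M
      S⊆M i = ∈-++⁺ʳ (map proj₁ B) i

      M-unique : Unique M
      M-unique = disjoint⇒unique M⊆F M-disjoint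

      share⇒≡ : ∀ {L} → AllPairs Disjoint L → A ∈ₗ L → A′ ∈ₗ L → v ∈ A → v ∈ A′ → A ≡ A′
      share⇒≡ (_ ∷ _)  (here refl) (here refl) _ _ = refl
      share⇒≡ (d ∷ _)  (here refl) (there j)   a b = ⊥-elim (All.lookup d j a b)
      share⇒≡ (d ∷ _)  (there i)   (here refl) a b = ⊥-elim (All.lookup d i b a)
      share⇒≡ (_ ∷ ds) (there i)   (there j)   a b = share⇒≡ ds i j a b

      M-share : A ∈ₗ M → A′ ∈ₗ M → v ∈ A → v ∈ A′ → A ≡ A′
      M-share = share⇒≡ M-disjoint

      B-disjoint : AllPairs (λ p q → Disjoint (proj₁ p) (proj₁ q)) B
      B-disjoint = AllPairs.map⁻ (proj₁ (allPairs-++⁻ (map proj₁ B) M-disjoint))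

      S-disjoint : AllPairs Disjoint S
      S-disjoint = proj₁ (proj₂ (allPairs-++⁻ (map proj₁ B) M-disjoint))

      S-unique : Unique S
      S-unique = disjoint⇒unique (All.++⁻ʳ (map proj₁ B) M⊆F) S-disjoint

      B-S-disjoint : ∀ {p} → p ∈ₗ B → A ∈ₗ S → Disjoint (proj₁ p) A
      B-S-disjoint i j = All.lookup (All.lookup (proj₂ (proj₂ (allPairs-++⁻ (map proj₁ B) M-disjoint))) (∈-map⁺ proj₁ i)) j

      -- Each member of M touched by Q is traded for a private edge at its chosen vertex. Such an edge adds
      -- two uncovered vertices and removes at least one touching incidence, so the budget 8 is never exceeded.
      trade : ∀ B′ → (∀ {p} → p ∈ₗ B′ → p ∈ₗ B) → AllPairs (λ p q → Disjoint (proj₁ p) (proj₁ q)) B′ →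
              ∀ Q → All (_∈ₗ F) Q → AllPairs Disjoint Q →
              (∀ {p q} → p ∈ₗ B′ → q ∈ₗ Q → proj₂ p ∉ q) →
              ∑ Q outside# + 2 * (∑[ p ← B′ ] ∑[ q ← Q ] (proj₁ p # q)) ≤ 8 →
              length B′ + length Q ≤ length B + length S
      trade [] _ _ Q Q⊆F dQ _ _ = maximum Q Q⊆F dQ
      trade ((A , x) ∷ B′) sub (dA ∷ dB) Q Q⊆F dQ avoid budget = step (∑[ q ← Q ] (A # q) ≟ 0)
        where
        open ≤-Reasoning
        A∈M : A ∈ₗ M
        A∈M = B⊆M (sub (here refl))
        x∈A : x ∈ A
        x∈A = proj₁ (All.lookup B-heavy (sub (here refl)))
        touch = ∑[ p ← B′ ] ∑[ q ← Q ] (proj₁ p # q)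
        onA = ∑[ q ← Q ] (A # q)

        extend : ∀ r → r ∈ₗ F → All (Disjoint r) Q → (∀ {p} → p ∈ₗ B′ → Disjoint (proj₁ p) r) →
                 outside# r ≤ 2 * onA → suc (length B′ + length Q) ≤ length B + length S
        extend r r∈F dr far small = subst (_≤ length B + length S) (+-suc (length B′) (length Q))
          (trade B′ (sub ∘ there) dB (r ∷ Q) (r∈F ∷ Q⊆F) (dr ∷ dQ)
            (λ { i (here refl) j → far i (proj₁ (All.lookup B-heavy (sub (there i)))) j ; i (there k) → avoid (there i) k })
            (begin
              (outside# r + ∑ Q outside#) + 2 * (∑[ p ← B′ ] (proj₁ p # r + ∑[ q ← Q ] (proj₁ p # q)))
                ≡⟨ cong (λ t → (outside# r + ∑ Q outside#) + 2 * t)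
                     (trans (∑-+ B′ (λ p → proj₁ p # r) (λ p → ∑[ q ← Q ] (proj₁ p # q)))
                            (cong (_+ touch) (∑-vanish B′ (λ i → disjoint⇒#≡0 (far i))))) ⟩
              (outside# r + ∑ Q outside#) + 2 * touch
                ≤⟨ +-monoˡ-≤ (2 * touch) (+-monoˡ-≤ (∑ Q outside#) small) ⟩
              (2 * onA + ∑ Q outside#) + 2 * touch
                ≡⟨ rearrange onA (∑ Q outside#) touch ⟩
              ∑ Q outside# + 2 * (onA + touch)
                ≤⟨ budget ⟩
              8 ∎))
          where
          rearrange : ∀ a o t → (2 * a + o) + 2 * t ≡ o + 2 * (a + t)
          rearrange = solve-∀

        step : Dec (onA ≡ 0) → suc (length B′ + length Q) ≤ length B + length S
        -- A heavy member that misses all of `Q` stays in the matching as it is; its vertices are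
        -- all covered, so it costs nothing.
        step (yes untouched) = extend A (All.lookup M⊆F A∈M)
          (All.tabulate λ {q} i → #≡0⇒disjoint {A = A} (n≤0⇒n≡0 (subst (A # q ≤_) untouched (term≤∑ (A #_) i))))
          (λ i → disjoint-sym (All.lookup dA i))
          (≤-trans (≤-reflexive (∑-vanish (elems A) λ {v} i → 𝟙-no (¬? (covered? v)) (λ ¬c → ¬c (∈⇒covered A∈M (∈-elems⁻ i))))) z≤n)
        step (no touched) with private-avoiding {x} Q (avoid (here refl)) few (∈⇒covered A∈M x∈A)
          where
          -- Touching `A` uses at least 2 of the budget 8, so `Q` has at most 6 uncovered vertices.
          few : ∑ Q outside# < privateDegree x
          few = ≤-trans (s≤s (+-cancelʳ-≤ 2 (∑ Q outside#) 6 (begin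
            ∑ Q outside# + 2 * 1              ≤⟨ +-monoʳ-≤ (∑ Q outside#) (*-monoʳ-≤ 2 (≤-trans (n≢0⇒n>0 touched) (m≤m+n onA touch))) ⟩
            ∑ Q outside# + 2 * (onA + touch)  ≤⟨ budget ⟩
            8                                 ∎)))
            (proj₂ (All.lookup B-heavy (sub (here refl))))
        ... | r , r∈F , p , dr = extend r r∈F dr
          (λ i j k → All.lookup dA i x∈A (subst (_∈ _) (private-only p k (∈⇒covered (B⊆M (sub (there i))) j)) j))
          (≤-trans (private-outside r∈F (∈⇒covered A∈M x∈A) p) (*-monoʳ-≤ 2 (n≢0⇒n>0 touched)))

      -- Augmentation by edges that avoid the chosen vertices.

      Avoiding : Subset n → Set
      Avoiding e = All (λ p → proj₂ p ∉ e) B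

      avoiding? : ∀ e → Dec (Avoiding e)
      avoiding? e = All.all? (λ p → ¬? (proj₂ p ∈? e)) B

      weight : Subset n → ℕ
      weight e = ∑[ A ← S ] (A # e)

      rest : Subset n → ℕ
      rest e = outside# e + ∑[ p ← B ] (proj₁ p # e)

      -- The members of `M` are disjoint, so each of the three vertices of `e` is counted at most
      -- once: as uncovered, in a heavy member or in a light one.
      rest+weight≤3 : e ∈ₗ F → rest e + weight e ≤ 3
      rest+weight≤3 {e} e∈F = begin
        outside# e + ∑[ p ← B ] (proj₁ p # e) + weight e
          ≡⟨ +-assoc (outside# e) (∑[ p ← B ] (proj₁ p # e)) (weight e) ⟩
        outside# e + (∑[ p ← B ] (proj₁ p # e) + weight e)
          ≡⟨ cong (outside# e +_) (trans (cong (_+ weight e) (sym (∑-map proj₁ B (_# e)))) (sym (∑-++ (map proj₁ B) S (_# e)))) ⟩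
        outside# e + ∑[ A ← M ] (A # e)
          ≡⟨ cong (outside# e +_) (trans (∑-cong M (λ A → #-comm A e)) (∑-swap M (elems e) χ)) ⟩
        outside# e + ∑[ v ← elems e ] ∑[ A ← M ] χ A v
          ≡⟨ ∑-+ (elems e) (λ v → 𝟙 (¬? (covered? v))) (λ v → ∑[ A ← M ] χ A v) ⟨
        ∑[ v ← elems e ] (𝟙 (¬? (covered? v)) + ∑[ A ← M ] χ A v)
          ≤⟨ ∑-≤-length (elems e) 1 (λ {v} _ → once v) ⟩
        length (elems e) * 1
          ≡⟨ trans (*-identityʳ _) (length-edge e∈F) ⟩
        3 ∎
        where
        open ≤-Reasoning
        once : ∀ v → 𝟙 (¬? (covered? v)) + ∑[ A ← M ] χ A v ≤ 1
        once v with covered? v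
        ... | yes _ = ∑-single M-unique
                        (λ {A} {A′} i j p q → M-share i j (𝟙-true (v ∈? A) p) (𝟙-true (v ∈? A′) q))
                        (λ {A} _ → 𝟙≤1 (v ∈? A))
        ... | no ¬c = s≤s (≤-reflexive (∑-vanish M λ {A} i → 𝟙-no (v ∈? A) (λ j → ¬c (∈⇒covered i j))))

      -- Replacing the light members in `I` by `P` keeps the light part disjoint, and `trade` then
      -- moves the heavy members out of the way; maximality forbids a gain. The bound 4 is half of
      -- the budget of `trade`.
      augment : ∀ P I → All (_∈ₗ F) P → AllPairs Disjoint P → All Avoiding P →
                (∀ {A e v} → A ∈ₗ S → e ∈ₗ P → v ∈ A → v ∈ e → A ∈ₗ I) →
                ∑ P rest ≤ 4 → length P ≤ length I
      augment P I P⊆F dP aP touched small = +-cancelˡ-≤ (length S′) (length P) (length I) (begin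
        length S′ + length P   ≡⟨ trans (+-comm (length S′) (length P)) (sym (length-++ P)) ⟩
        length (P ++ S′)       ≤⟨ +-cancelˡ-≤ (length B) (length (P ++ S′)) (length S) traded ⟩
        length S               ≤⟨ length-⊆ _≟ˢ_ S-unique split ⟩
        length (S′ ++ I)       ≡⟨ length-++ S′ ⟩
        length S′ + length I   ∎)
        where
        open ≤-Reasoning
        open DecMembership _≟ˢ_ using () renaming (_∈?_ to _∈ₗ?_)
        other? : ∀ A → Dec (A ∉ₗ I)
        other? A = ¬? (A ∈ₗ? I)
        S′ = filter other? S
        S′⊆S : ∀ {A} → A ∈ₗ S′ → A ∈ₗ S
        S′⊆S i = proj₁ (∈-filter⁻ other? i)
        split : ∀ {A} → A ∈ₗ S → A ∈ₗ S′ ++ I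
        split {A} i with A ∈ₗ? I
        ... | yes j = ∈-++⁺ʳ S′ j
        ... | no ∉I = ∈-++⁺ˡ (∈-filter⁺ other? i ∉I)
        budget : ∑ (P ++ S′) outside# + 2 * (∑[ p ← B ] ∑[ q ← P ++ S′ ] (proj₁ p # q)) ≤ 8
        budget = begin
          ∑ (P ++ S′) outside# + 2 * (∑[ p ← B ] ∑[ q ← P ++ S′ ] (proj₁ p # q))
            ≡⟨ cong₂ (λ s t → s + 2 * t)
                 (trans (∑-++ P S′ outside#) (trans (cong (∑ P outside# +_) (∑-vanish S′ λ {A} i →
                   ∑-vanish (elems A) λ {v} j → 𝟙-no (¬? (covered? v)) λ ¬c → ¬c (∈⇒covered (S⊆M (S′⊆S i)) (∈-elems⁻ j))))
                   (+-identityʳ _)))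
                 (trans (trans (∑-swap B (P ++ S′) (λ p q → proj₁ p # q)) (∑-++ P S′ (λ q → ∑[ p ← B ] (proj₁ p # q))))
                   (trans (cong (∑[ q ← P ] ∑[ p ← B ] (proj₁ p # q) +_) (∑-vanish S′ λ {A} i →
                     ∑-vanish B λ j → disjoint⇒#≡0 (B-S-disjoint j (S′⊆S i)))) (+-identityʳ _))) ⟩
          ∑ P outside# + 2 * (∑[ q ← P ] ∑[ p ← B ] (proj₁ p # q))
            -- Uncovered vertices cost 1 and incidences with heavy members 2; charging 2 for both
            -- gives twice `rest`.
            ≤⟨ +-monoˡ-≤ _ (m≤n*m (∑ P outside#) 2) ⟩
          2 * ∑ P outside# + 2 * (∑[ q ← P ] ∑[ p ← B ] (proj₁ p # q))
            ≡⟨ *-distribˡ-+ 2 (∑ P outside#) (∑[ q ← P ] ∑[ p ← B ] (proj₁ p # q)) ⟨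
          2 * (∑ P outside# + ∑[ q ← P ] ∑[ p ← B ] (proj₁ p # q))
            ≡⟨ cong (2 *_) (∑-+ P outside# (λ q → ∑[ p ← B ] (proj₁ p # q))) ⟨
          2 * ∑ P rest
            ≤⟨ *-monoʳ-≤ 2 small ⟩
          8 ∎
        traded : length B + length (P ++ S′) ≤ length B + length S
        traded = trade B (λ i → i) B-disjoint (P ++ S′)
          (All.++⁺ P⊆F (All.tabulate λ i → All.lookup M⊆F (S⊆M (S′⊆S i))))
          (AllPairs.++⁺ dP (AllPairs.filter⁺ other? S-disjoint)
            (All.tabulate λ i → All.tabulate λ j k l → proj₂ (∈-filter⁻ other? {xs = S} j) (touched (S′⊆S j) i l k)))
          avoid budget
          where
          avoid : ∀ {p q} → p ∈ₗ B → q ∈ₗ P ++ S′ → proj₂ p ∉ q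
          avoid i j with ∈-++⁻ P j
          ... | inj₁ j∈P  = All.lookup (All.lookup aP j∈P) i
          ... | inj₂ j∈S′ = B-S-disjoint i (S′⊆S j∈S′) (proj₁ (All.lookup B-heavy i))

      Small : Fin n → Set
      Small v = Any (v ∈_) S

      -- Used to refute an assumed weight of 1 or 2 by exhibiting one light vertex too many.
      vertices≤weight : ∀ vs → Unique vs → All (_∈ e) vs → All Small vs → length vs ≤ weight e
      vertices≤weight {e} vs u in-e small = begin
        length vs                                ≡⟨ ∑-1 vs ⟨
        ∑[ _ ← vs ] 1                            ≤⟨ ∑-mono vs (λ {v} i → once v (find (All.lookup small i))) ⟩
        ∑[ v ← vs ] ∑[ A ← S ] χ A v             ≤⟨ ∑-⊆ _≟ᶠ_ (λ v → ∑[ A ← S ] χ A v) u (λ i → ∈-elems⁺ (All.lookup in-e i)) ⟩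
        ∑[ v ← elems e ] ∑[ A ← S ] χ A v        ≡⟨ ∑-swap S (elems e) χ ⟨
        ∑[ A ← S ] (e # A)                       ≡⟨ ∑-cong S (λ A → #-comm e A) ⟩
        weight e                                 ∎
        where
        open ≤-Reasoning
        once : ∀ v → (∃ λ A → A ∈ₗ S × v ∈ A) → 1 ≤ ∑[ A ← S ] χ A v
        once v (A , i , j) = ≤-trans (≤-reflexive (sym (𝟙-yes (v ∈? A) j))) (term≤∑ (λ A → χ A v) i)

      -- Otherwise `augment` would add `e` without removing any light member.
      avoiding⇒weight≢0 : e ∈ₗ F → Avoiding e → weight e ≢ 0
      avoiding⇒weight≢0 {e} e∈F av w≡0 = contradiction
        (augment (e ∷ []) [] (e∈F ∷ []) ([] ∷ []) (av ∷ [])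
          (λ { {A} i (here refl) j k →
               ⊥-elim (#≡0⇒disjoint {A = A} (n≤0⇒n≡0 (subst (A # e ≤_) w≡0 (term≤∑ (_# e) i))) j k) })
          (begin
            rest e + 0          ≡⟨ +-identityʳ (rest e) ⟩
            rest e              ≤⟨ m≤m+n (rest e) (weight e) ⟩
            rest e + weight e   ≤⟨ rest+weight≤3 e∈F ⟩
            3                   ≤⟨ n≤1+n 3 ⟩
            4                   ∎))
        λ ()
        where open ≤-Reasoning

      -- Edges with a single vertex in light members.

      Single : Subset n → Set
      Single e = Avoiding e × weight e ≡ 1

      single? : ∀ e → Dec (Single e)
      single? e = avoiding? e ×-dec (weight e ≟ 1)

      single-vertex : Single e → a ∈ e → v ∈ e → Small a → Small v → a ≡ v
      single-vertex {e} {a} {v} (_ , w≡1) ae ve sa sv with a ≟ᶠ v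
      ... | yes a≡v = a≡v
      ... | no a≢v  = contradiction
        (subst (2 ≤_) w≡1 (vertices≤weight (a ∷ v ∷ []) ((a≢v ∷ []) ∷ [] ∷ []) (ae ∷ ve ∷ []) (sa ∷ sv ∷ [])))
        λ { (s≤s ()) }

      single-rest : e ∈ₗ F → Single e → rest e ≤ 2
      single-rest {e} e∈F (_ , w≡1) = +-cancelʳ-≤ 1 (rest e) 2 (subst (λ w → rest e + w ≤ 3) w≡1 (rest+weight≤3 e∈F))

      -- Two disjoint such edges could replace `A` alone. Each has at most 2 vertices off the light
      -- members, which exactly exhausts the allowance of `augment`.
      singles-meet : A ∈ₗ S → a ∈ A → b ∈ A → e ∈ₗ F → f ∈ₗ F → Single e → Single f → a ∈ e → b ∈ f → ¬ Disjoint e f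
      singles-meet {A} {a} {b} {e} {f} A∈S aA bA e∈F f∈F se sf ae bf d = contradiction
        (augment (e ∷ f ∷ []) (A ∷ []) (e∈F ∷ f∈F ∷ []) (((λ {x} → d {x}) ∷ []) ∷ [] ∷ []) (proj₁ se ∷ proj₁ sf ∷ [])
          (λ { i (here refl) j k         → here (only i j (single-vertex se ae k (lose A∈S aA) (lose i j)) aA)
             ; i (there (here refl)) j k → here (only i j (single-vertex sf bf k (lose A∈S bA) (lose i j)) bA) })
          (+-mono-≤ (single-rest e∈F se) (+-mono-≤ (single-rest f∈F sf) z≤n)))
        λ { (s≤s ()) }
        where
        only : A′ ∈ₗ S → v ∈ A′ → x ≡ v → x ∈ A → A′ ≡ A
        only i j refl k = M-share (S⊆M i) (S⊆M A∈S) j k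

      singleDegree : Fin n → ℕ
      singleDegree a = ∑[ e ← F ] 𝟙 (single? e ×-dec a ∈? e)

      count-through : ∀ {P : Subset n → Set} (P? : ∀ e → Dec (P e)) → (∀ {e} → P e → a ∈ e) → a ≢ v →
                      ∑[ e ← F ] 𝟙 (P? e ×-dec v ∈? e) ≤ 1
      count-through {v = v} P? through a≢v = ∑-single F-unique
        (λ {e} {f} i j p q → let pe , ve = 𝟙-true (P? e ×-dec v ∈? e) p
                                 pf , vf = 𝟙-true (P? f ×-dec v ∈? f) q
                             in edge-unique i j a≢v (through pe) ve (through pf) vf)
        (λ {e} _ → 𝟙≤1 (P? e ×-dec v ∈? e))

      -- An edge counted at b meets each of the edges counted at a, in different vertices other than b.
      singleDegree-conflict : A ∈ₗ S → a ∈ A → b ∈ A → a ≢ b → 0 < singleDegree b → singleDegree a ≤ 2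
      singleDegree-conflict {A} {a} {b} A∈S aA bA a≢b pos with ∑-pos F (λ e → 𝟙 (single? e ×-dec b ∈? e)) pos
      ... | f , f∈F , p with sf , bf ← 𝟙-true (single? f ×-dec b ∈? f) p = s≤s⁻¹ (begin-strict
        singleDegree a
          ≤⟨ ∑-mono F (λ {e} i → 𝟙-≤ (single? e ×-dec a ∈? e) (hit i)) ⟩
        ∑[ e ← F ] ∑[ u ← elems f ] t e u
          ≡⟨ ∑-swap F (elems f) t ⟩
        ∑[ u ← elems f ] ∑[ e ← F ] t e u
          ≤⟨ ∑-mono (elems f) (λ {u} i → once u (∈-elems⁻ i)) ⟩
        ∑[ u ← elems f ] 𝟙 (¬? (u ≟ᶠ b))
          <⟨ ∑-≢ _≟ᶠ_ (∈-elems⁺ bf) ⟩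
        length (elems f)
          ≡⟨ length-edge f∈F ⟩
        3 ∎)
        where
        open ≤-Reasoning
        t : Subset n → Fin n → ℕ
        t e u = 𝟙 ((single? e ×-dec a ∈? e) ×-dec u ∈? e)
        a∉f : a ∉ f
        a∉f af = a≢b (single-vertex sf af bf (lose A∈S aA) (lose A∈S bA))
        hit : e ∈ₗ F → Single e × a ∈ e → 1 ≤ ∑[ u ← elems f ] t e u
        hit {e} e∈F (se , ae) with meet? e f
        ... | inj₂ d             = ⊥-elim (singles-meet A∈S aA bA e∈F f∈F se sf ae bf d)
        ... | inj₁ (u , ue , uf) = ≤-trans (≤-reflexive (sym (𝟙-yes ((single? e ×-dec a ∈? e) ×-dec u ∈? e) ((se , ae) , ue))))
                                           (term≤∑ (t e) (∈-elems⁺ uf))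
        once : ∀ u → u ∈ f → ∑[ e ← F ] t e u ≤ 𝟙 (¬? (u ≟ᶠ b))
        once u uf with u ≟ᶠ b
        ... | no _     = count-through {v = u} (λ e → single? e ×-dec a ∈? e) proj₂ (λ { refl → a∉f uf })
        ... | yes refl = ≤-reflexive (∑-vanish F λ {e} _ → 𝟙-no ((single? e ×-dec a ∈? e) ×-dec u ∈? e)
                           λ ((se , ae) , ue) → a≢b (single-vertex se ae ue (lose A∈S aA) (lose A∈S bA)))

      -- Since `a` is the only light vertex of `e`, any further covered vertex lies in a heavy
      -- member, and it is not the chosen one because `e` is avoiding.
      single-cases : A ∈ₗ S → a ∈ A → Single e → a ∈ e →
                     Private a e ⊎ ∃ λ p → ∃ λ v → p ∈ₗ B × v ∈ proj₁ p × v ∈ e × v ≢ proj₂ p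
      single-cases {A} {a} {e} A∈S aA se ae with All.all? (λ v → covered? v →-dec v ≟ᶠ a) (elems e)
      ... | yes only = inj₁ (ae , only)
      ... | no ¬only with find (¬All⇒Any¬ (λ v → covered? v →-dec v ≟ᶠ a) (elems e) ¬only)
      ... | v , v∈ , ¬imp with covered? v | v ≟ᶠ a
      ... | no ¬c | _       = contradiction (λ c → contradiction c ¬c) ¬imp
      ... | yes _ | yes v≡a = contradiction (λ _ → v≡a) ¬imp
      ... | yes c | no v≢a with find (covered⇒∈ c)
      ... | A′ , A′∈M , vA′ with ∈-++⁻ (map proj₁ B) A′∈M
      ... | inj₂ A′∈S = contradiction (single-vertex se (∈-elems⁻ v∈) ae (lose A′∈S vA′) (lose A∈S aA)) v≢a
      ... | inj₁ A′∈B with ∈-map⁻ proj₁ A′∈B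
      ... | p , p∈B , refl = inj₂ (p , v , p∈B , vA′ , ∈-elems⁻ v∈ , λ { refl → All.lookup (proj₁ se) p∈B (∈-elems⁻ v∈) })

      -- At most 6 of these edges are private, as `A` is light. Every other one passes through one
      -- of the two vertices of some heavy member that are not chosen, and by linearity each such
      -- vertex accounts for at most one edge.
      singleDegree-bound : A ∈ₗ S → a ∈ A → singleDegree a ≤ 6 + length B * 2
      singleDegree-bound {A} {a} A∈S aA = begin
        singleDegree a
          ≤⟨ ∑-mono F (λ {e} _ → 𝟙-≤ (single? e ×-dec a ∈? e) (λ (se , ae) → hit e se ae)) ⟩
        ∑[ e ← F ] (𝟙 (private? a e) + ∑[ p ← B ] ∑[ y ← elems (proj₁ p) ] t p y e)
          ≡⟨ ∑-+ F (λ e → 𝟙 (private? a e)) (λ e → ∑[ p ← B ] ∑[ y ← elems (proj₁ p) ] t p y e) ⟩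
        privateDegree a + ∑[ e ← F ] ∑[ p ← B ] ∑[ y ← elems (proj₁ p) ] t p y e
          ≤⟨ +-monoˡ-≤ _ (All.lookup S-light A∈S aA) ⟩
        6 + ∑[ e ← F ] ∑[ p ← B ] ∑[ y ← elems (proj₁ p) ] t p y e
          ≡⟨ cong (6 +_) (∑-swap F B (λ e p → ∑[ y ← elems (proj₁ p) ] t p y e)) ⟩
        6 + ∑[ p ← B ] ∑[ e ← F ] ∑[ y ← elems (proj₁ p) ] t p y e
          ≤⟨ +-monoʳ-≤ 6 (∑-≤-length B 2 two) ⟩
        6 + length B * 2 ∎
        where
        open ≤-Reasoning
        t : Subset n × Fin n → Fin n → Subset n → ℕ
        t p y e = 𝟙 (((single? e ×-dec a ∈? e) ×-dec ¬? (y ≟ᶠ proj₂ p)) ×-dec y ∈? e)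
        two : ∀ {p} → p ∈ₗ B → ∑[ e ← F ] ∑[ y ← elems (proj₁ p) ] t p y e ≤ 2
        two {p} p∈B = s≤s⁻¹ (begin-strict
          ∑[ e ← F ] ∑[ y ← elems (proj₁ p) ] t p y e
            ≡⟨ ∑-swap F (elems (proj₁ p)) (λ e y → t p y e) ⟩
          ∑[ y ← elems (proj₁ p) ] ∑[ e ← F ] t p y e
            ≤⟨ ∑-mono (elems (proj₁ p)) (λ {y} i → once y (∈-elems⁻ i)) ⟩
          ∑[ y ← elems (proj₁ p) ] 𝟙 (¬? (y ≟ᶠ proj₂ p))
            <⟨ ∑-≢ _≟ᶠ_ (∈-elems⁺ (proj₁ (All.lookup B-heavy p∈B))) ⟩
          length (elems (proj₁ p))
            ≡⟨ length-edge (All.lookup M⊆F (B⊆M p∈B)) ⟩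
          3 ∎)
          where
          once : ∀ y → y ∈ proj₁ p → ∑[ e ← F ] t p y e ≤ 𝟙 (¬? (y ≟ᶠ proj₂ p))
          once y y∈ with y ≟ᶠ proj₂ p
          ... | no y≢x   = count-through {v = y} (λ e → (single? e ×-dec a ∈? e) ×-dec ¬? (no y≢x)) (proj₂ ∘ proj₁)
                             (λ { refl → B-S-disjoint p∈B A∈S y∈ aA })
          ... | yes y≡x  = ≤-reflexive (∑-vanish F λ {e} _ →
                             𝟙-no (((single? e ×-dec a ∈? e) ×-dec ¬? (yes y≡x)) ×-dec y ∈? e) λ ((_ , y≢x) , _) → y≢x y≡x)
        hit : ∀ e → Single e → a ∈ e → 1 ≤ 𝟙 (private? a e) + ∑[ p ← B ] ∑[ y ← elems (proj₁ p) ] t p y e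
        hit e se ae with single-cases A∈S aA se ae
        ... | inj₁ priv = ≤-trans (≤-reflexive (sym (𝟙-yes (private? a e) priv))) (m≤m+n _ _)
        ... | inj₂ (p , v , p∈B , v∈A′ , ve , v≢x) = ≤-trans (begin
          1                                     ≡⟨ 𝟙-yes (((single? e ×-dec a ∈? e) ×-dec ¬? (v ≟ᶠ proj₂ p)) ×-dec v ∈? e)
                                                     (((se , ae) , v≢x) , ve) ⟨
          t p v e                               ≤⟨ term≤∑ (λ y → t p y e) (∈-elems⁺ v∈A′) ⟩
          ∑[ y ← elems (proj₁ p) ] t p y e      ≤⟨ term≤∑ (λ p → ∑[ y ← elems (proj₁ p) ] t p y e) p∈B ⟩
          ∑[ p ← B ] ∑[ y ← elems (proj₁ p) ] t p y e ∎) (m≤n+m _ (𝟙 (private? a e)))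

      -- If some vertex of `A` has more than 2 such edges, then by `singleDegree-conflict` the other
      -- vertices have none, and `singleDegree-bound` applies to it alone. Otherwise the sum is at
      -- most 3 times 2.
      singles≤ : A ∈ₗ S → ∑ (elems A) singleDegree ≤ 6 + length B * 2
      singles≤ {A} A∈S with All.all? (λ a → singleDegree a ≤? 2) (elems A)
      ... | yes low = ≤-trans (∑-≤-length (elems A) 2 (All.lookup low))
                        (≤-trans (≤-reflexive (cong (_* 2) (length-edge (All.lookup M⊆F (S⊆M A∈S))))) (m≤m+n 6 _))
      ... | no ¬low with find (¬All⇒Any¬ (λ a → singleDegree a ≤? 2) (elems A) ¬low)
      ... | a , a∈ , high = ∑-single (elems-unique A) (λ i j p q → trans (sym (here-only i p)) (here-only j q))
                              (λ i → singleDegree-bound A∈S (∈-elems⁻ i))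
        where
        here-only : b ∈ₗ elems A → 0 < singleDegree b → a ≡ b
        here-only {b} i pos with a ≟ᶠ b
        ... | yes a≡b = a≡b
        ... | no a≢b  = contradiction (singleDegree-conflict A∈S (∈-elems⁻ a∈) (∈-elems⁻ i) a≢b pos) high

      -- Edges with two light vertices as coloured pairs.

      -- The pair ab with colour z. The field `only` spells out the vertex set, so that disjointness
      -- of two such edges reduces to comparing named vertices.
      record Join (a b z : Fin n) : Set where
        field
          edge    : Subset n
          edge∈F  : edge ∈ₗ F
          avoids  : Avoiding edge
          weight₂ : weight edge ≡ 2
          a∈      : a ∈ edge
          b∈      : b ∈ edge
          z∈      : z ∈ edge
          only    : ∀ {v} → v ∈ edge → v ≡ a ⊎ v ≡ b ⊎ v ≡ z
          a-small : Small a
          b-small : Small b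
          z-large : ¬ Small z
          a≢b     : a ≢ b

      open Join

      flip : Join a b z → Join b a z
      flip j = record
        { edge = edge j ; edge∈F = edge∈F j ; avoids = avoids j ; weight₂ = weight₂ j
        ; a∈ = b∈ j ; b∈ = a∈ j ; z∈ = z∈ j
        ; only = λ i → case only j i of λ { (inj₁ p) → inj₂ (inj₁ p) ; (inj₂ (inj₁ p)) → inj₁ p ; (inj₂ (inj₂ p)) → inj₂ (inj₂ p) }
        ; a-small = b-small j ; b-small = a-small j ; z-large = z-large j ; a≢b = λ p → a≢b j (sym p) }

      -- The decidable form without the colour, used for counting; `join` recovers the colour.
      Joined : Fin n → Fin n → Set
      Joined a b = Any (λ e → (Avoiding e × weight e ≡ 2) × a ∈ e × b ∈ e) F

      joined? : ∀ a b → Dec (Joined a b)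
      joined? a b = Any.any? (λ e → (avoiding? e ×-dec (weight e ≟ 2)) ×-dec (a ∈? e ×-dec b ∈? e)) F

      third-vertex : e ∈ₗ F → a ∈ e → b ∈ e → a ≢ b →
                     ∃ λ z → z ∈ e × z ≢ a × z ≢ b × (∀ {v} → v ∈ e → v ≡ a ⊎ v ≡ b ⊎ v ≡ z)
      third-vertex {e} {a} {b} e∈F ae be a≢b with All.all? (λ v → v ∈ₗ? (a ∷ b ∷ [])) (elems e)
        where open DecMembership _≟ᶠ_ using () renaming (_∈?_ to _∈ₗ?_)
      ... | yes all = contradiction (subst (_≤ 2) (length-edge e∈F) (length-⊆ _≟ᶠ_ (elems-unique e) (All.lookup all)))
                                    λ { (s≤s (s≤s ())) }
      ... | no ¬all with find (¬All⇒Any¬ (λ v → v ∈ₗ? (a ∷ b ∷ [])) (elems e) ¬all)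
        where open DecMembership _≟ᶠ_ using () renaming (_∈?_ to _∈ₗ?_)
      ... | z , z∈ , z∉ab = z , ∈-elems⁻ z∈ , z≢a , z≢b , only′
        where
        z≢a : z ≢ a
        z≢a p = z∉ab (here p)
        z≢b : z ≢ b
        z≢b p = z∉ab (there (here p))
        only′ : ∀ {v} → v ∈ e → v ≡ a ⊎ v ≡ b ⊎ v ≡ z
        only′ {v} ve with v ≟ᶠ a | v ≟ᶠ b | v ≟ᶠ z
        ... | yes p | _     | _     = inj₁ p
        ... | no _  | yes p | _     = inj₂ (inj₁ p)
        ... | no _  | no _  | yes p = inj₂ (inj₂ p)
        ... | no va | no vb | no vz = contradiction
          (subst (4 ≤_) (length-edge e∈F) (length-⊆ _≟ᶠ_ {K = v ∷ z ∷ a ∷ b ∷ []}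
            ((vz ∷ va ∷ vb ∷ []) ∷ (z≢a ∷ z≢b ∷ []) ∷ (a≢b ∷ []) ∷ [] ∷ [])
            (All.lookup (∈-elems⁺ ve ∷ z∈ ∷ ∈-elems⁺ ae ∷ ∈-elems⁺ be ∷ []))))
          λ { (s≤s (s≤s (s≤s ()))) }

      join : Small a → Small b → a ≢ b → Joined a b → ∃ (Join a b)
      join {a} {b} sa sb a≢b any with find any
      ... | e , e∈F , (av , w) , ae , be with third-vertex e∈F ae be a≢b
      ... | z , ze , z≢a , z≢b , only′ = z , record
        { edge = e ; edge∈F = e∈F ; avoids = av ; weight₂ = w ; a∈ = ae ; b∈ = be ; z∈ = ze ; only = only′
        ; a-small = sa ; b-small = sb ; a≢b = a≢b
        -- A third light vertex would raise the weight to 3.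
        ; z-large = λ sz → contradiction
            (subst (3 ≤_) w (vertices≤weight (z ∷ a ∷ b ∷ []) ((z≢a ∷ z≢b ∷ []) ∷ (a≢b ∷ []) ∷ [] ∷ [])
              (ze ∷ ae ∷ be ∷ []) (sz ∷ sa ∷ sb ∷ [])))
            λ { (s≤s (s≤s ())) } }

      -- The colouring is proper: a vertex and a colour at it are two vertices of the edge, distinct
      -- since only the first is light, so by linearity they determine the edge.
      join-proper : Join a b z → Join a c z → b ≡ c
      join-proper {a} {b} {z} {c} j k with edge-unique (edge∈F j) (edge∈F k) (λ { refl → z-large j (a-small j) }) (a∈ j) (z∈ j) (a∈ k) (z∈ k)
      ... | same with only j (subst (c ∈_) (sym same) (b∈ k))
      ... | inj₁ c≡a         = contradiction (sym c≡a) (a≢b k)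
      ... | inj₂ (inj₁ c≡b)  = sym c≡b
      ... | inj₂ (inj₂ refl) = contradiction (b-small k) (z-large k)

      Coloured : Set
      Coloured = ∃ λ ((a , b , z) : Fin n × Fin n × Fin n) → Join a b z

      -- Colours need comparing only with colours, as they lie off the light members.
      Apart : Coloured → Coloured → Set
      Apart ((a , b , z) , _) ((c , d , w) , _) = a ≢ c × a ≢ d × b ≢ c × b ≢ d × z ≢ w

      apart⇒disjoint : ∀ {j k} → Apart j k → Disjoint (edge (proj₂ j)) (edge (proj₂ k))
      apart⇒disjoint {_ , j} {_ , k} (ac , ad , bc , bd , zw) p q with only j p | only k q
      ... | inj₁ refl        | inj₁ refl        = ac refl
      ... | inj₁ refl        | inj₂ (inj₁ refl) = ad refl
      ... | inj₁ refl        | inj₂ (inj₂ refl) = z-large k (a-small j)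
      ... | inj₂ (inj₁ refl) | inj₁ refl        = bc refl
      ... | inj₂ (inj₁ refl) | inj₂ (inj₁ refl) = bd refl
      ... | inj₂ (inj₁ refl) | inj₂ (inj₂ refl) = z-large k (b-small j)
      ... | inj₂ (inj₂ refl) | inj₁ refl        = z-large j (a-small k)
      ... | inj₂ (inj₂ refl) | inj₂ (inj₁ refl) = z-large j (b-small k)
      ... | inj₂ (inj₂ refl) | inj₂ (inj₂ refl) = zw refl

      -- Each edge of weight 2 has at most one vertex off the light members, so up to four of them
      -- fit into the allowance of `augment`.
      rainbow : ∀ I js → All (_∈ₗ S) I → length js ≤ 4 →
                All (λ ((a , b , _) , _) → Any (a ∈_) I × Any (b ∈_) I) js →
                AllPairs Apart js → length js ≤ length I
      rainbow I js I⊆S ≤4 within apart = subst (_≤ length I) (length-map (edge ∘ proj₂) js) (augment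
        (map (edge ∘ proj₂) js) I
        (All.map⁺ (All.universal (edge∈F ∘ proj₂) js))
        (AllPairs.map⁺ (AllPairs.map (λ {j} {k} p {x} → apart⇒disjoint {j} {k} p {x}) apart))
        (All.map⁺ (All.universal (avoids ∘ proj₂) js))
        touched
        (begin
          ∑ (map (edge ∘ proj₂) js) rest     ≡⟨ ∑-map (edge ∘ proj₂) js rest ⟩
          ∑ js (rest ∘ edge ∘ proj₂)         ≤⟨ ∑-≤-length js 1 (λ {(_ , j)} _ → rest≤1 j) ⟩
          length js * 1                      ≡⟨ *-identityʳ (length js) ⟩
          length js                          ≤⟨ ≤4 ⟩
          4                                  ∎))
        where
        open ≤-Reasoning
        rest≤1 : (j : Join a b z) → rest (edge j) ≤ 1
        rest≤1 j = +-cancelʳ-≤ 2 (rest (edge j)) 1 (subst (λ w → rest (edge j) + w ≤ 3) (weight₂ j) (rest+weight≤3 (edge∈F j)))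
        inside-I : A ∈ₗ S → v ∈ A → Any (v ∈_) I → A ∈ₗ I
        inside-I i j k with find k
        ... | A′ , A′∈I , v∈A′ = subst (_∈ₗ I) (M-share (S⊆M (All.lookup I⊆S A′∈I)) (S⊆M i) v∈A′ j) A′∈I
        touched : ∀ {A e v} → A ∈ₗ S → e ∈ₗ map (edge ∘ proj₂) js → v ∈ A → v ∈ e → A ∈ₗ I
        touched i j p q with ∈-map⁻ (edge ∘ proj₂) j
        ... | (_ , j′) , j′∈ , refl with only j′ q | All.lookup within j′∈
        ... | inj₁ refl        | aI , _  = inside-I i p aI
        ... | inj₂ (inj₁ refl) | _  , bI = inside-I i p bI
        ... | inj₂ (inj₂ refl) | _       = contradiction (lose i p) (z-large j′)

      -- Colour patterns on the pairs between two members.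

      -- A chosen order of the three vertices, so that the pair that may be missing can be put in
      -- the last row and column.
      record Labelling (A : Subset n) : Set where
        field
          at     : Fin 3 → Fin n
          at∈    : ∀ i → at i ∈ A
          at-inj : ∀ {i j} → at i ≡ at j → i ≡ j
          ∑-at   : ∀ f → ∑ (elems A) f ≡ f (at 0F) + (f (at 1F) + f (at 2F))

      open Labelling

      labelling : x ∷ y ∷ z ∷ [] ↭ elems A → Labelling A
      labelling {x} {y} {z} {A} p = record
        { at = at′
        ; at∈ = λ { 0F → ∈-elems⁻ (Any-resp-↭ p (here refl)) ; 1F → ∈-elems⁻ (Any-resp-↭ p (there (here refl)))
                  ; 2F → ∈-elems⁻ (Any-resp-↭ p (there (there (here refl)))) }
        ; at-inj = inj (unique-↭ (↭-sym p) (elems-unique A))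
        ; ∑-at = λ f → trans (sym (∑-↭ f p)) (cong (λ t → f x + (f y + t)) (+-identityʳ (f z))) }
        where
        at′ : Fin 3 → Fin n
        at′ 0F = x
        at′ 1F = y
        at′ 2F = z
        inj : Unique (x ∷ y ∷ z ∷ []) → ∀ {i j} → at′ i ≡ at′ j → i ≡ j
        inj _ {0F} {0F} _ = refl
        inj _ {1F} {1F} _ = refl
        inj _ {2F} {2F} _ = refl
        inj ((xy ∷ _) ∷ _)      {0F} {1F} e = contradiction e xy
        inj ((_ ∷ xz ∷ _) ∷ _)  {0F} {2F} e = contradiction e xz
        inj ((xy ∷ _) ∷ _)      {1F} {0F} e = contradiction (sym e) xy
        inj (_ ∷ (yz ∷ _) ∷ _)  {1F} {2F} e = contradiction e yz
        inj ((_ ∷ xz ∷ _) ∷ _)  {2F} {0F} e = contradiction (sym e) xz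
        inj (_ ∷ (yz ∷ _) ∷ _)  {2F} {1F} e = contradiction (sym e) yz

      some-labelling : A ∈ₗ S → Labelling A
      some-labelling {A} A∈S with elems A in eq | length-edge (All.lookup M⊆F (S⊆M A∈S))
      ... | x ∷ y ∷ z ∷ [] | _ = labelling (subst (x ∷ y ∷ z ∷ [] ↭_) (sym eq) ↭-refl)

      -- The pairs of vertices of A and B lying in an edge with its third vertex off S, coloured by that vertex:
      --   γ β δ
      --   δ α β
      --   α γ
      record Rigid {A B : Subset n} (a : Labelling A) (b : Labelling B) : Set where
        field
          {α β γ δ} : Fin n
          j00 : Join (at a 0F) (at b 0F) γ
          j01 : Join (at a 0F) (at b 1F) β
          j02 : Join (at a 0F) (at b 2F) δ
          j10 : Join (at a 1F) (at b 0F) δ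
          j11 : Join (at a 1F) (at b 1F) α
          j12 : Join (at a 1F) (at b 2F) β
          j20 : Join (at a 2F) (at b 0F) α
          j21 : Join (at a 2F) (at b 1F) γ

      pairs : Fin n → Subset n → ℕ
      pairs u A = ∑[ v ← elems A ] 𝟙 (joined? u v)

      slots : Subset n → Subset n → ℕ
      slots A B = ∑[ u ← elems A ] pairs u B

      members-apart : A ∈ₗ S → A′ ∈ₗ S → A ≢ A′ → v ∈ A → w ∈ A′ → v ≢ w
      members-apart i j A≢A′ p q refl = A≢A′ (M-share (S⊆M i) (S⊆M j) p q)

      open DecUnique (_≟ᶠ_ {3}) using (unique?)

      module Pair {A B : Subset n} (A∈S : A ∈ₗ S) (B∈S : B ∈ₗ S) (A≢B : A ≢ B) (a : Labelling A) (b : Labelling B) where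

        a≢b′ : ∀ i j → at a i ≢ at b j
        a≢b′ i j = members-apart A∈S B∈S A≢B (at∈ a i) (at∈ b j)

        row-proper : ∀ {i j k z w} → j ≢ k → Join (at a i) (at b j) z → Join (at a i) (at b k) w → z ≢ w
        row-proper j≢k p q refl = j≢k (at-inj b (join-proper p q))

        col-proper : ∀ {i j k z w} → i ≢ j → Join (at a i) (at b k) z → Join (at a j) (at b k) w → z ≢ w
        col-proper i≢j p q refl = i≢j (at-inj a (join-proper (flip p) (flip q)))

        -- Three different colours would give a rainbow matching of three pairs within the two
        -- members `A` and `B`.
        transversal : ∀ {i j k x y z} → {True (unique? (i ∷ j ∷ k ∷ []))} →
                      Join (at a 0F) (at b i) x → Join (at a 1F) (at b j) y → Join (at a 2F) (at b k) z →
                      x ≡ y ⊎ y ≡ z ⊎ x ≡ z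
        transversal {i} {j} {k} {x} {y} {z} {u} p q r with x ≟ᶠ y | y ≟ᶠ z | x ≟ᶠ z
        ... | yes e | _     | _     = inj₁ e
        ... | no _  | yes e | _     = inj₂ (inj₁ e)
        ... | no _  | no _  | yes e = inj₂ (inj₂ e)
        ... | no xy | no yz | no xz with toWitness u
        ... | (ij ∷ ik ∷ []) ∷ (jk ∷ []) ∷ [] ∷ [] = contradiction
          (rainbow (A ∷ B ∷ []) ((_ , p) ∷ (_ , q) ∷ (_ , r) ∷ []) (A∈S ∷ B∈S ∷ []) (s≤s (s≤s (s≤s z≤n)))
            ((here (at∈ a 0F) , there (here (at∈ b i))) ∷ (here (at∈ a 1F) , there (here (at∈ b j)))
              ∷ (here (at∈ a 2F) , there (here (at∈ b k))) ∷ [])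
            ((sep {0F} {1F} (λ ()) ij xy ∷ sep {0F} {2F} (λ ()) ik xz ∷ []) ∷ (sep {1F} {2F} (λ ()) jk yz ∷ []) ∷ [] ∷ []))
          λ { (s≤s (s≤s ())) }
          where
          sep : ∀ {i j k l} {z w : Fin n} → i ≢ j → k ≢ l → z ≢ w →
                at a i ≢ at a j × at a i ≢ at b l × at b k ≢ at a j × at b k ≢ at b l × z ≢ w
          sep ij kl zw = ij ∘ at-inj a , a≢b′ _ _ , a≢b′ _ _ ∘ sym , kl ∘ at-inj b , zw

        mk : ∀ i j → Joined (at a i) (at b j) → ∃ (Join (at a i) (at b j))
        mk i j = join (lose A∈S (at∈ a i)) (lose B∈S (at∈ b j)) (a≢b′ i j)

        -- The eight cells are properly coloured, and four transversals avoid the ninth;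
        -- `two-colourings` leaves two patterns.
        rigid : (∀ k → Joined (at a 0F) (at b k)) → (∀ k → Joined (at a 1F) (at b k)) →
                Joined (at a 2F) (at b 0F) → Joined (at a 2F) (at b 1F) → Rigid a b ⊎ Rigid b a
        rigid r₀ r₁ r₂₀ r₂₁
          with _ , p ← mk 0F 0F (r₀ 0F) | _ , q ← mk 0F 1F (r₀ 1F) | _ , r ← mk 0F 2F (r₀ 2F)
             | _ , s ← mk 1F 0F (r₁ 0F) | _ , t ← mk 1F 1F (r₁ 1F) | _ , u ← mk 1F 2F (r₁ 2F)
             | _ , v ← mk 2F 0F r₂₀     | _ , w ← mk 2F 1F r₂₁
          with two-colourings
                 (row-proper (λ ()) p q) (row-proper (λ ()) p r) (row-proper (λ ()) q r)
                 (row-proper (λ ()) s t) (row-proper (λ ()) s u) (row-proper (λ ()) t u) (row-proper (λ ()) v w)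
                 (col-proper (λ ()) p s) (col-proper (λ ()) p v) (col-proper (λ ()) s v)
                 (col-proper (λ ()) q t) (col-proper (λ ()) q w) (col-proper (λ ()) t w) (col-proper (λ ()) r u)
                 (transversal r t v) (transversal p u w) (transversal q u v) (transversal r s w)
        ... | inj₁ (refl , refl , refl , refl) = inj₁ record
          { j00 = p ; j01 = q ; j02 = r ; j10 = s ; j11 = t ; j12 = u ; j20 = v ; j21 = w }
        -- The second pattern is the transpose of the first, so the roles of `a` and `b` are
        -- exchanged.
        ... | inj₂ (refl , refl , refl , refl) = inj₂ record
          { j00 = flip p ; j01 = flip s ; j02 = flip v ; j10 = flip q ; j11 = flip t ; j12 = flip w ; j20 = flip r ; j21 = flip u }

      all-joined : ∀ {u} (b : Labelling A) → 3 ≤ pairs u A → ∀ k → Joined u (at b k)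
      all-joined {u = u} b full = all-three (λ k → joined? u (at b k)) (subst (3 ≤_) (∑-at b (λ w → 𝟙 (joined? u w))) full)

      pairs≤3 : A ∈ₗ S → ∀ u → pairs u A ≤ 3
      pairs≤3 {A} A∈S u = ≤-trans (∑-≤-length (elems A) 1 (λ {v} _ → 𝟙≤1 (joined? u v)))
                                  (≤-reflexive (trans (*-identityʳ _) (length-edge (All.lookup M⊆F (S⊆M A∈S)))))

      -- Pairs sent from a nearly full pair of members to a third member.

      module Triple {A B C : Subset n} (A∈S : A ∈ₗ S) (B∈S : B ∈ₗ S) (C∈S : C ∈ₗ S)
        (A≢B : A ≢ B) (A≢C : A ≢ C) (B≢C : B ≢ C) (a : Labelling A) (b : Labelling B) (c : Labelling C) where

        -- α and β are the colours of two disjoint pairs between A and B that miss u and v.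
        Blocked : Fin n → Fin n → Fin n → Fin n → Set
        Blocked u v α β = ∀ {k l z w} → k ≢ l → Join u (at c k) z → Join v (at c l) w →
                          z ≢ α → z ≢ β → w ≢ α → w ≢ β → z ≢ w → ⊥

        blocked-sym : ∀ {u v α β} → Blocked u v α β → Blocked v u α β
        blocked-sym bl k≢l p q zα zβ wα wβ zw = bl (k≢l ∘ sym) q p wα wβ zα zβ (zw ∘ sym)

        blocked-swap : ∀ {u v α β} → Blocked u v α β → Blocked u v β α
        blocked-swap bl k≢l p q zα zβ wα wβ zw = bl k≢l p q zβ zα wβ wα zw

        -- The pairs coloured `α` and `β` and two disjoint pairs towards `C` with other, distinct
        -- colours would form a rainbow matching of four pairs within three members.
        blocked : ∀ {i i′ i″ j j′ j″ α β} → {True (unique? (i ∷ i′ ∷ i″ ∷ []))} → {True (unique? (j ∷ j′ ∷ j″ ∷ []))} →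
                  α ≢ β → Join (at a i′) (at b j′) α → Join (at a i″) (at b j″) β → Blocked (at a i) (at b j) α β
        blocked {i} {i′} {i″} {j} {j′} {j″} {_} {_} {I} {J} αβ p q {k} {l} kl r s zα zβ wα wβ zw
          with toWitness I | toWitness J
        ... | (ii′ ∷ ii″ ∷ []) ∷ (i′i″ ∷ []) ∷ [] ∷ [] | (jj′ ∷ jj″ ∷ []) ∷ (j′j″ ∷ []) ∷ [] ∷ [] = contradiction
          (rainbow (A ∷ B ∷ C ∷ []) ((_ , p) ∷ (_ , q) ∷ (_ , r) ∷ (_ , s) ∷ []) (A∈S ∷ B∈S ∷ C∈S ∷ [])
            (s≤s (s≤s (s≤s (s≤s z≤n))))
            ((inA i′ , inB j′) ∷ (inA i″ , inB j″) ∷ (inA i , inC k) ∷ (inB j , inC l) ∷ [])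
            ( ((i′i″ ∘ at-inj a , ab i′ j″ , ab i″ j′ ∘ sym , j′j″ ∘ at-inj b , αβ)
               ∷ (ii′ ∘ sym ∘ at-inj a , ac i′ k , ab i j′ ∘ sym , bc j′ k , zα ∘ sym)
               ∷ (ab i′ j , ac i′ l , jj′ ∘ sym ∘ at-inj b , bc j′ l , wα ∘ sym) ∷ [])
            ∷ ((ii″ ∘ sym ∘ at-inj a , ac i″ k , ab i j″ ∘ sym , bc j″ k , zβ ∘ sym)
               ∷ (ab i″ j , ac i″ l , jj″ ∘ sym ∘ at-inj b , bc j″ l , wβ ∘ sym) ∷ [])
            ∷ ((ab i j , ac i l , bc j k ∘ sym , kl ∘ at-inj c , zw) ∷ [])
            ∷ [] ∷ []))
          λ { (s≤s (s≤s (s≤s ()))) }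
          where
          ab : ∀ i j → at a i ≢ at b j
          ab i j = members-apart A∈S B∈S A≢B (at∈ a i) (at∈ b j)
          ac : ∀ i j → at a i ≢ at c j
          ac i j = members-apart A∈S C∈S A≢C (at∈ a i) (at∈ c j)
          bc : ∀ i j → at b i ≢ at c j
          bc i j = members-apart B∈S C∈S B≢C (at∈ b i) (at∈ c j)
          inA : ∀ i → Any (at a i ∈_) (A ∷ B ∷ C ∷ [])
          inA i = here (at∈ a i)
          inB : ∀ j → Any (at b j ∈_) (A ∷ B ∷ C ∷ [])
          inB j = there (here (at∈ b j))
          inC : ∀ k → Any (at c k ∈_) (A ∷ B ∷ C ∷ [])
          inC k = there (there (here (at∈ c k)))

        Free : Fin n → Fin n → Set
        Free u α = ∀ {k z} → Join u (at c k) z → z ≢ α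

        -- By properness a colour occurs only once at a vertex, and here it is spent on a pair
        -- towards `B`.
        freeᵃ : ∀ {i j α} → Join (at a i) (at b j) α → Free (at a i) α
        freeᵃ {j = j} p {k} q refl = members-apart B∈S C∈S B≢C (at∈ b j) (at∈ c k) (join-proper p q)

        freeᵇ : ∀ {i j α} → Join (at a i) (at b j) α → Free (at b j) α
        freeᵇ {i = i} p {k} q refl = members-apart A∈S C∈S A≢C (at∈ a i) (at∈ c k) (join-proper (flip p) q)

        others : (k : Fin 3) → ∃ λ l → ∃ λ m → k ≢ l × k ≢ m × l ≢ m
        others 0F = 1F , 2F , (λ ()) , (λ ()) , (λ ())
        others 1F = 0F , 2F , (λ ()) , (λ ()) , (λ ())
        others 2F = 0F , 1F , (λ ()) , (λ ()) , (λ ())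

        c-proper : ∀ {u k l z w} → k ≢ l → Join u (at c k) z → Join u (at c l) w → z ≢ w
        c-proper k≢l p q refl = k≢l (at-inj c (join-proper p q))

        module _ {u v α β : Fin n} (bl : Blocked u v α β) (uα : Free u α) (uβ : Free u β)
                 (u-joins : ∀ k → Joined u (at c k) → ∃ (Join u (at c k)))
                 (v-joins : ∀ k → Joined v (at c k) → ∃ (Join v (at c k)))
                 (full : 3 ≤ pairs u C) where

          full-joins : ∀ k → ∃ (Join u (at c k))
          full-joins k = u-joins k (all-joined c full k)

          -- The two pairs from u missing a given vertex of C have different colours.
          none-good : ∀ {k z} → Join v (at c k) z → z ≢ α → z ≢ β → ⊥
          none-good {k} {z} p zα zβ with others k
          ... | l , m , kl , km , lm with full-joins l | full-joins m
          ... | x , q | y , r with x ≟ᶠ z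
          ... | no x≢z   = bl (kl ∘ sym) q p (uα q) (uβ q) zα zβ x≢z
          ... | yes refl = bl (km ∘ sym) r p (uα r) (uβ r) zα zβ (c-proper (lm ∘ sym) r q)

          -- Two pairs from `v` have different colours, so one of them is not `α`; neither is `β`,
          -- and `none-good` excludes it.
          pairs≤1 : Free v β → pairs v C ≤ 1
          pairs≤1 vβ = ≮⇒≥ λ two → go (two-of-three (λ k → joined? v (at c k)) (subst (2 ≤_) (∑-at c (λ w → 𝟙 (joined? v w))) two))
            where
            go : (∃ λ k → ∃ λ l → k ≢ l × Joined v (at c k) × Joined v (at c l)) → ⊥
            go (k , l , kl , p , q) with v-joins k p | v-joins l q
            ... | x , p′ | y , q′ with x ≟ᶠ α
            ... | no x≢α   = none-good p′ x≢α (vβ p′)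
            ... | yes refl = none-good q′ (c-proper (kl ∘ sym) q′ p′) (vβ q′)

          -- Three pairs from `v` have three colours, one of which is neither `α` nor `β`.
          pairs≤2 : pairs v C ≤ 2
          pairs≤2 = ≮⇒≥ λ three → go (all-joined c three)
            where
            go : (∀ k → Joined v (at c k)) → ⊥
            go ps with v-joins 0F (ps 0F) | v-joins 1F (ps 1F) | v-joins 2F (ps 2F)
            ... | x , p | y , q | z , r with x ≟ᶠ α | x ≟ᶠ β | y ≟ᶠ α | y ≟ᶠ β
            ... | no xα | no xβ | _     | _     = none-good p xα xβ
            ... | _     | _     | no yα | no yβ = none-good q yα yβ
            ... | yes refl | _ | yes refl | _ = c-proper (λ ()) p q refl
            ... | yes refl | _ | no _ | yes refl = none-good r (c-proper (λ ()) r p) (c-proper (λ ()) r q)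
            ... | no _ | yes refl | yes refl | _ = none-good r (c-proper (λ ()) r q) (c-proper (λ ()) r p)
            ... | no _ | yes refl | no _ | yes refl = c-proper (λ ()) p q refl

        joinᵃ : ∀ i k → Joined (at a i) (at c k) → ∃ (Join (at a i) (at c k))
        joinᵃ i k = join (lose A∈S (at∈ a i)) (lose C∈S (at∈ c k)) (members-apart A∈S C∈S A≢C (at∈ a i) (at∈ c k))

        joinᵇ : ∀ j k → Joined (at b j) (at c k) → ∃ (Join (at b j) (at c k))
        joinᵇ j k = join (lose B∈S (at∈ b j)) (lose C∈S (at∈ c k)) (members-apart B∈S C∈S B≢C (at∈ b j) (at∈ c k))

        -- For suitable i and j, if one of `at a i` and `at b j` sends three pairs to `C`, then the
        -- other sends at most one. Two disjoint pairs off row i and column j of the array carry the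
        -- colour of the pair ij, which is free at both ends, and a second colour free at the full
        -- end.
        rigid⇒sparse : Rigid a b → slots A C + slots B C ≤ 13
        rigid⇒sparse R = ≤-trans
          (≤-reflexive (cong₂ _+_ (∑-at a (λ u → pairs u C)) (∑-at b (λ u → pairs u C))))
          (degrees≤13 (≤3 (at a 0F)) (≤3 (at a 1F)) (≤3 (at a 2F)) (≤3 (at b 0F)) (≤3 (at b 1F)) (≤3 (at b 2F))
            h₀₀ h₀₂ h₁₁ h₁₂ k₁₀ k₀₁ k₀₂ k₁₂ h₂₂)
          where
          open Rigid R
          open Pair A∈S B∈S A≢B a b using (row-proper; col-proper)
          βγ : β ≢ γ
          βγ = row-proper (λ ()) j01 j00
          δγ : δ ≢ γ
          δγ = row-proper (λ ()) j02 j00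
          δα : δ ≢ α
          δα = row-proper (λ ()) j10 j11
          βα : β ≢ α
          βα = row-proper (λ ()) j12 j11
          γα : γ ≢ α
          γα = row-proper (λ ()) j21 j20
          ≤3 = pairs≤3 C∈S
          fromᵃ : ∀ i j α β → Blocked (at a i) (at b j) α β → Free (at a i) α → Free (at a i) β → Free (at b j) β →
                  3 ≤ pairs (at a i) C → pairs (at b j) C ≤ 1
          fromᵃ i j α β bl p q r full = pairs≤1 {at a i} {at b j} {α} {β} bl p q (joinᵃ i) (joinᵇ j) full r
          fromᵇ : ∀ i j α β → Blocked (at a i) (at b j) α β → Free (at b j) α → Free (at b j) β → Free (at a i) β →
                  3 ≤ pairs (at b j) C → pairs (at a i) C ≤ 1
          fromᵇ i j α β bl p q r full = pairs≤1 {at b j} {at a i} {α} {β} (blocked-sym bl) p q (joinᵇ j) (joinᵃ i) full r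
          h₀₀ : 3 ≤ pairs (at a 0F) C → pairs (at b 0F) C ≤ 1
          h₀₀ = fromᵃ 0F 0F β γ (blocked βγ j12 j21) (freeᵃ j01) (freeᵃ j00) (freeᵇ j00)
          h₀₂ : 3 ≤ pairs (at a 0F) C → pairs (at b 2F) C ≤ 1
          h₀₂ = fromᵃ 0F 2F γ δ (blocked-swap (blocked δγ j10 j21)) (freeᵃ j00) (freeᵃ j02) (freeᵇ j02)
          h₁₁ : 3 ≤ pairs (at a 1F) C → pairs (at b 1F) C ≤ 1
          h₁₁ = fromᵃ 1F 1F δ α (blocked δα j02 j20) (freeᵃ j10) (freeᵃ j11) (freeᵇ j11)
          h₁₂ : 3 ≤ pairs (at a 1F) C → pairs (at b 2F) C ≤ 1
          h₁₂ = fromᵃ 1F 2F α β (blocked-swap (blocked βα j01 j20)) (freeᵃ j11) (freeᵃ j12) (freeᵇ j12)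
          k₁₀ : 3 ≤ pairs (at b 1F) C → pairs (at a 0F) C ≤ 1
          k₁₀ = fromᵇ 0F 1F α β (blocked-swap (blocked βα j12 j20)) (freeᵇ j11) (freeᵇ j01) (freeᵃ j01)
          k₀₁ : 3 ≤ pairs (at b 0F) C → pairs (at a 1F) C ≤ 1
          k₀₁ = fromᵇ 1F 0F γ δ (blocked-swap (blocked δγ j02 j21)) (freeᵇ j00) (freeᵇ j10) (freeᵃ j10)
          k₀₂ : 3 ≤ pairs (at b 0F) C → pairs (at a 2F) C ≤ 1
          k₀₂ = fromᵇ 2F 0F δ α (blocked δα j02 j11) (freeᵇ j10) (freeᵇ j20) (freeᵃ j20)
          k₁₂ : 3 ≤ pairs (at b 1F) C → pairs (at a 2F) C ≤ 1
          k₁₂ = fromᵇ 2F 1F β γ (blocked βγ j12 j00) (freeᵇ j01) (freeᵇ j21) (freeᵃ j21)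
          -- No cell of the pattern in the last column carries either colour, so only the weaker
          -- bound 2 is available.
          h₂₂ : 3 ≤ pairs (at a 2F) C → pairs (at b 2F) C ≤ 2
          h₂₂ = pairs≤2 {at a 2F} {at b 2F} {γ} {α} (blocked γα j00 j11) (freeᵃ j21) (freeᵃ j20) (joinᵃ 2F) (joinᵇ 2F)

      -- At most one of the nine pairs is missing. Ordering first the vertices of `A` and then those
      -- of `B` by `relabel` moves it to the last cell, where `rigid` does not look.
      full⇒sparse : ∀ {A B C} → A ∈ₗ S → B ∈ₗ S → C ∈ₗ S → A ≢ B → A ≢ C → B ≢ C →
                    8 ≤ slots A B → slots A C + slots B C ≤ 13
      full⇒sparse {A} {B} {C} A∈S B∈S C∈S A≢B A≢C B≢C full =
        let a₀ , a₁ , a₂ , p , full₀ , full₁ , full₂ =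
              relabel (elems A) (λ u → pairs u B) 3 (length-edge (All.lookup M⊆F (S⊆M A∈S))) (λ {u} _ → pairs≤3 B∈S u) (s≤s full)
        in columns a₀ a₁ a₂ p full₀ full₁ full₂
        where
        sparse : (a : Labelling A) (b : Labelling B) → Rigid a b ⊎ Rigid b a → slots A C + slots B C ≤ 13
        sparse a b (inj₁ R) = Triple.rigid⇒sparse A∈S B∈S C∈S A≢B A≢C B≢C a b (some-labelling C∈S) R
        sparse a b (inj₂ R) = ≤-trans (≤-reflexive (+-comm (slots A C) (slots B C)))
          (Triple.rigid⇒sparse B∈S A∈S C∈S (A≢B ∘ sym) B≢C A≢C b a (some-labelling C∈S) R)
        columns : ∀ a₀ a₁ a₂ → a₀ ∷ a₁ ∷ a₂ ∷ [] ↭ elems A → 3 ≤ pairs a₀ B → 3 ≤ pairs a₁ B → 3 ≤ suc (pairs a₂ B) →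
                  slots A C + slots B C ≤ 13
        columns a₀ a₁ a₂ p full₀ full₁ full₂ =
          let b₀ , b₁ , b₂ , q , full₂₀ , full₂₁ , _ =
                relabel (elems B) (λ v → 𝟙 (joined? a₂ v)) 1 (length-edge (All.lookup M⊆F (S⊆M B∈S)))
                  (λ {v} _ → 𝟙≤1 (joined? a₂ v)) full₂
              b = labelling q
          in sparse (labelling p) b (Pair.rigid A∈S B∈S A≢B (labelling p) b
               (all-joined {u = a₀} b full₀) (all-joined {u = a₁} b full₁)
               (𝟙-true (joined? a₂ b₀) full₂₀) (𝟙-true (joined? a₂ b₁) full₂₁))

      -- Weights carried by pairs of light members.

      level : ℕ → ℕ
      level 2 = 3
      level 3 = 1
      level _ = 0

      level≤3 : ∀ m → level m ≤ 3
      level≤3 0 = z≤n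
      level≤3 1 = z≤n
      level≤3 2 = ≤-refl
      level≤3 3 = s≤s z≤n
      level≤3 (suc (suc (suc (suc _)))) = z≤n

      level≤1 : ∀ m → m ≢ 2 → level m ≤ 1
      level≤1 0 _ = z≤n
      level≤1 1 _ = z≤n
      level≤1 2 h = contradiction refl h
      level≤1 3 _ = ≤-refl
      level≤1 (suc (suc (suc (suc _)))) _ = z≤n

      -- An edge with k vertices in members of S is seen by k choose 2 pairs of members; the total is 3 for k = 2 and for k = 3.
      factor : Subset n → ℕ
      factor e = 𝟙 (avoiding? e) * level (weight e)

      factor≤3 : ∀ e → factor e ≤ 3
      factor≤3 e = *-mono-≤ (𝟙≤1 (avoiding? e)) (level≤3 (weight e))

      factor≤1 : ∀ e → ¬ (Avoiding e × weight e ≡ 2) → factor e ≤ 1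
      factor≤1 e h = cases (avoiding? e)
        where
        cases : (d : Dec (Avoiding e)) → 𝟙 d * level (weight e) ≤ 1
        cases (yes av) = ≤-trans (≤-reflexive (*-identityˡ _)) (level≤1 (weight e) (λ w → h (av , w)))
        cases (no _)   = z≤n

      pairWeight : Subset n → Subset n → ℕ
      pairWeight A B = ∑[ e ← F ] (factor e * (A # e * B # e))

      pairWeight-expand : ∀ A B → pairWeight A B ≡ ∑[ a ← elems A ] ∑[ b ← elems B ] ∑[ e ← F ] (factor e * (χ e a * χ e b))
      pairWeight-expand A B = begin
        ∑[ e ← F ] (factor e * (A # e * B # e))
          ≡⟨ ∑-cong F (λ e → sym (product (factor e) (χ e) (χ e))) ⟩
        ∑[ e ← F ] ∑[ a ← elems A ] ∑[ b ← elems B ] (factor e * (χ e a * χ e b))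
          ≡⟨ ∑-swap F (elems A) (λ e a → ∑[ b ← elems B ] (factor e * (χ e a * χ e b))) ⟩
        ∑[ a ← elems A ] ∑[ e ← F ] ∑[ b ← elems B ] (factor e * (χ e a * χ e b))
          ≡⟨ ∑-cong (elems A) (λ a → ∑-swap F (elems B) (λ e b → factor e * (χ e a * χ e b))) ⟩
        ∑[ a ← elems A ] ∑[ b ← elems B ] ∑[ e ← F ] (factor e * (χ e a * χ e b)) ∎
        where
        open ≡-Reasoning
        product : ∀ k (f g : Fin n → ℕ) →
                  ∑[ a ← elems A ] ∑[ b ← elems B ] (k * (f a * g b)) ≡ k * (∑ (elems A) f * ∑ (elems B) g)
        product k f g = begin
          ∑[ a ← elems A ] ∑[ b ← elems B ] (k * (f a * g b))
            ≡⟨ ∑-cong (elems A) (λ a → trans (∑-*ˡ (elems B) k (λ b → f a * g b))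
                 (trans (cong (k *_) (∑-*ˡ (elems B) (f a) g)) (cong (k *_) (*-comm (f a) (∑ (elems B) g))))) ⟩
          ∑[ a ← elems A ] (k * (∑ (elems B) g * f a))
            ≡⟨ trans (∑-*ˡ (elems A) k (λ a → ∑ (elems B) g * f a)) (cong (k *_) (∑-*ˡ (elems A) (∑ (elems B) g) f)) ⟩
          k * (∑ (elems B) g * ∑ (elems A) f)
            ≡⟨ cong (k *_) (*-comm (∑ (elems B) g) (∑ (elems A) f)) ⟩
          k * (∑ (elems A) f * ∑ (elems B) g) ∎

      -- By linearity at most one edge contains both vertices. Its factor is at most 3 if it makes
      -- them a coloured pair and at most 1 otherwise.
      vertexPairWeight≤ : a ≢ b → ∑[ e ← F ] (factor e * (χ e a * χ e b)) ≤ 1 + 2 * 𝟙 (joined? a b)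
      vertexPairWeight≤ {a} {b} a≢b = ∑-single F-unique
        (λ {e} {f} i j p q → edge-unique i j a≢b (in₁ e p) (in₂ e p) (in₁ f q) (in₂ f q))
        (λ {e} i → bound i (a ∈? e) (b ∈? e) (avoiding? e ×-dec (weight e ≟ 2)))
        where
        in₁ : ∀ e → 0 < factor e * (χ e a * χ e b) → a ∈ e
        in₁ e p = 𝟙-true (a ∈? e) (0<*ˡ (χ e a) (χ e b) (0<*ʳ (factor e) (χ e a * χ e b) p))
        in₂ : ∀ e → 0 < factor e * (χ e a * χ e b) → b ∈ e
        in₂ e p = 𝟙-true (b ∈? e) (0<*ʳ (χ e a) (χ e b) (0<*ʳ (factor e) (χ e a * χ e b) p))
        bound : e ∈ₗ F → (p : Dec (a ∈ e)) (q : Dec (b ∈ e)) → Dec (Avoiding e × weight e ≡ 2) →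
                factor e * (𝟙 p * 𝟙 q) ≤ 1 + 2 * 𝟙 (joined? a b)
        bound {e} i (no _)   _        _       = ≤-trans (≤-reflexive (*-zeroʳ (factor e))) z≤n
        bound {e} i (yes _)  (no _)   _       = ≤-trans (≤-reflexive (*-zeroʳ (factor e))) z≤n
        bound {e} i (yes ae) (yes be) (no ¬g) = ≤-trans (≤-reflexive (*-identityʳ (factor e))) (≤-trans (factor≤1 e ¬g) (m≤m+n 1 _))
        bound {e} i (yes ae) (yes be) (yes g) = ≤-trans (≤-reflexive (*-identityʳ (factor e))) (≤-trans (factor≤3 e)
          (≤-reflexive (sym (cong (λ t → 1 + 2 * t) (𝟙-yes (joined? a b) (lose i (g , ae , be)))))))

      -- Each of the nine vertex pairs gives at most 1, and a coloured one at most 2 more.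
      pairWeight≤ : ∀ {A B} → A ∈ₗ S → B ∈ₗ S → A ≢ B → pairWeight A B ≤ 9 + 2 * slots A B
      pairWeight≤ {A} {B} A∈S B∈S A≢B = begin
        pairWeight A B
          ≡⟨ pairWeight-expand A B ⟩
        ∑[ a ← elems A ] ∑[ b ← elems B ] ∑[ e ← F ] (factor e * (χ e a * χ e b))
          ≤⟨ ∑-mono (elems A) (λ {a} i → ∑-mono (elems B) (λ {b} j →
               vertexPairWeight≤ (members-apart A∈S B∈S A≢B (∈-elems⁻ i) (∈-elems⁻ j)))) ⟩
        ∑[ a ← elems A ] ∑[ b ← elems B ] (1 + 2 * 𝟙 (joined? a b))
          ≡⟨ ∑-cong (elems A) (λ a → affine B B∈S (λ b → 𝟙 (joined? a b)) 1) ⟩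
        ∑[ a ← elems A ] (3 + 2 * pairs a B)
          ≡⟨ affine A A∈S (λ a → pairs a B) 3 ⟩
        9 + 2 * slots A B ∎
        where
        open ≤-Reasoning
        affine : ∀ A → A ∈ₗ S → (f : Fin n → ℕ) (k : ℕ) → ∑[ a ← elems A ] (k + 2 * f a) ≡ 3 * k + 2 * ∑ (elems A) f
        affine A A∈S f k = trans (∑-+ (elems A) (λ _ → k) (λ a → 2 * f a))
          (cong₂ _+_ (trans (constant (elems A)) (cong (_* k) (length-edge (All.lookup M⊆F (S⊆M A∈S))))) (∑-*ˡ (elems A) 2 f))
          where
          constant : ∀ (L : List (Fin n)) → ∑[ _ ← L ] k ≡ length L * k
          constant []      = refl
          constant (_ ∷ L) = cong (k +_) (constant L)

      pairWeight≤27 : ∀ {A B} → A ∈ₗ S → B ∈ₗ S → A ≢ B → pairWeight A B ≤ 27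
      pairWeight≤27 {A} {B} A∈S B∈S A≢B = ≤-trans (pairWeight≤ A∈S B∈S A≢B) (+-monoʳ-≤ 9 (*-monoʳ-≤ 2 (begin
        slots A B               ≤⟨ ∑-≤-length (elems A) 3 (λ {u} _ → pairs≤3 B∈S u) ⟩
        length (elems A) * 3    ≡⟨ cong (_* 3) (length-edge (All.lookup M⊆F (S⊆M A∈S))) ⟩
        9                       ∎)))
        where open ≤-Reasoning

      -- The total weight over all pairs of light members.

      -- The second elementary symmetric polynomial in the intersection sizes of `e` with the
      -- members of the list.
      pairSum : List (Subset n) → Subset n → ℕ
      pairSum []      e = 0
      pairSum (A ∷ L) e = A # e * ∑ L (_# e) + pairSum L e

      pairSum-↭ : ∀ {L K} e → L ↭ K → pairSum L e ≡ pairSum K e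
      pairSum-↭ e ↭-refl     = refl
      pairSum-↭ e (prep A p) = cong₂ (λ s t → A # e * s + t) (∑-↭ (_# e) p) (pairSum-↭ e p)
      pairSum-↭ {_ ∷ _ ∷ L} {_ ∷ _ ∷ K} e (swap A B p) =
        trans (cong₂ (λ s t → A # e * (B # e + s) + (B # e * s + t)) (∑-↭ (_# e) p) (pairSum-↭ e p))
              (exchange (A # e) (B # e) (∑ K (_# e)) (pairSum K e))
        where
        exchange : ∀ a b s t → a * (b + s) + (b * s + t) ≡ b * (a + s) + (a * s + t)
        exchange = solve-∀
      pairSum-↭ e (↭-tr p q) = trans (pairSum-↭ e p) (pairSum-↭ e q)

      totalWeight : List (Subset n) → ℕ
      totalWeight L = ∑[ e ← F ] (factor e * pairSum L e)

      totalWeight-∷ : ∀ A L → totalWeight (A ∷ L) ≡ ∑[ B ← L ] pairWeight A B + totalWeight L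
      totalWeight-∷ A L = begin
        ∑[ e ← F ] (factor e * (A # e * ∑ L (_# e) + pairSum L e))
          ≡⟨ ∑-cong F (λ e → trans (*-distribˡ-+ (factor e) (A # e * ∑ L (_# e)) (pairSum L e)) (cong (_+ factor e * pairSum L e)
               (sym (trans (∑-*ˡ L (factor e) (λ B → A # e * B # e)) (cong (factor e *_) (∑-*ˡ L (A # e) (_# e))))))) ⟩
        ∑[ e ← F ] (∑[ B ← L ] (factor e * (A # e * B # e)) + factor e * pairSum L e)
          ≡⟨ ∑-+ F (λ e → ∑[ B ← L ] (factor e * (A # e * B # e))) (λ e → factor e * pairSum L e) ⟩
        ∑[ e ← F ] ∑[ B ← L ] (factor e * (A # e * B # e)) + totalWeight L
          ≡⟨ cong (_+ totalWeight L) (∑-swap F L (λ e B → factor e * (A # e * B # e))) ⟩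
        ∑[ B ← L ] pairWeight A B + totalWeight L ∎
        where open ≡-Reasoning

      -- A pair with at least 8 slots is removed together: it overshoots 23 by at most 4,
      -- but makes up for it with every other member of the list.
      totalWeight≤ : ∀ k L → length L ≤ k → Unique L → All (_∈ₗ S) L →
                     2 * totalWeight L + 19 * length L ≤ 23 * (length L * length L)
      totalWeight≤ k [] _ _ _ = ≤-reflexive (cong (λ t → 2 * t + 0) (∑-vanish F (λ {e} _ → *-zeroʳ (factor e))))
      -- For l members the bound reads 23 l(l - 1)/2 + 2l: the 4 by which an exceptional pair may
      -- exceed 23 is paid from the 2 granted to each of its members. The recursion is on `k`, since
      -- removing a pair permutes the list.
      totalWeight≤ (suc k) (A ∷ L) (s≤s ≤k) (A∉L ∷ u) (A∈S ∷ L⊆S) = cases (Any.any? (λ B → 8 ≤? slots A B) L)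
        where
        open ≤-Reasoning
        cases : Dec (Any (λ B → 8 ≤ slots A B) L) →
                2 * totalWeight (A ∷ L) + 19 * suc (length L) ≤ 23 * (suc (length L) * suc (length L))
        cases (no none) = begin
          2 * totalWeight (A ∷ L) + 19 * suc (length L)
            ≡⟨ cong (λ t → 2 * t + 19 * suc (length L)) (totalWeight-∷ A L) ⟩
          2 * (∑[ B ← L ] pairWeight A B + totalWeight L) + 19 * suc (length L)
            ≤⟨ +-monoˡ-≤ (19 * suc (length L)) (*-monoʳ-≤ 2 (+-monoˡ-≤ (totalWeight L) (∑-≤-length L 23 sparse))) ⟩
          2 * (length L * 23 + totalWeight L) + 19 * suc (length L)
            ≡⟨ regroup (length L) (totalWeight L) ⟩
          (2 * totalWeight L + 19 * length L) + (46 * length L + 19)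
            ≤⟨ +-mono-≤ (totalWeight≤ k L ≤k u L⊆S) (+-monoʳ-≤ (46 * length L) (m≤m+n 19 4)) ⟩
          23 * (length L * length L) + (46 * length L + 23)
            ≡⟨ square (length L) ⟩
          23 * (suc (length L) * suc (length L)) ∎
          where
          -- At most 7 slots give 9 + 2 · 7 = 23.
          sparse : ∀ {B} → B ∈ₗ L → pairWeight A B ≤ 23
          sparse i = ≤-trans (pairWeight≤ A∈S (All.lookup L⊆S i) (All.lookup A∉L i))
                       (+-monoʳ-≤ 9 (*-monoʳ-≤ 2 (≮⇒≥ (λ h → none (lose i h)))))
          regroup : ∀ l t → 2 * (l * 23 + t) + 19 * suc l ≡ (2 * t + 19 * l) + (46 * l + 19)
          regroup = solve-∀
          square : ∀ l → 23 * (l * l) + (46 * l + 23) ≡ 23 * (suc l * suc l)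
          square = solve-∀
        cases (yes some) with find some
        ... | B , B∈L , full with ∈-∃++ B∈L
        ... | L₁ , L₂ , refl = remove (L₁ ++ L₂) (shift B L₁ L₂)
          where
          remove : ∀ K → L ↭ B ∷ K → 2 * totalWeight (A ∷ L) + 19 * suc (length L) ≤ 23 * (suc (length L) * suc (length L))
          remove K p = go (All-resp-↭ p A∉L) (unique-↭ p u) (All-resp-↭ p L⊆S)
            where
            l≡ : length L ≡ suc (length K)
            l≡ = ↭-length p
            go : All (A ≢_) (B ∷ K) → Unique (B ∷ K) → All (_∈ₗ S) (B ∷ K) →
                 2 * totalWeight (A ∷ L) + 19 * suc (length L) ≤ 23 * (suc (length L) * suc (length L))
            go (A≢B ∷ A∉K) (B∉K ∷ uK) (B∈S ∷ K⊆S) = begin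
              2 * totalWeight (A ∷ L) + 19 * suc (length L)
                ≡⟨ cong₂ (λ t l → 2 * t + 19 * suc l)
                     (trans (∑-cong F (λ e → cong (factor e *_) (pairSum-↭ e (prep A p)))) (totalWeight-∷ A (B ∷ K))) l≡ ⟩
              2 * ((pairWeight A B + ∑[ C ← K ] pairWeight A C) + totalWeight (B ∷ K)) + 19 * suc (suc (length K))
                ≡⟨ cong (λ t → 2 * ((pairWeight A B + ∑[ C ← K ] pairWeight A C) + t) + 19 * suc (suc (length K)))
                     (totalWeight-∷ B K) ⟩
              2 * ((pairWeight A B + ∑[ C ← K ] pairWeight A C) + (∑[ C ← K ] pairWeight B C + totalWeight K)) + 19 * suc (suc (length K))
                ≡⟨ regroup (pairWeight A B) (∑[ C ← K ] pairWeight A C) (∑[ C ← K ] pairWeight B C) (totalWeight K) (length K) ⟩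
              (2 * totalWeight K + 19 * length K) + (2 * (pairWeight A B + (∑[ C ← K ] pairWeight A C + ∑[ C ← K ] pairWeight B C)) + 38)
                ≤⟨ +-mono-≤ (totalWeight≤ k K K≤k uK K⊆S)
                     (+-monoˡ-≤ 38 (*-monoʳ-≤ 2 (+-mono-≤ (pairWeight≤27 A∈S B∈S A≢B)
                       (≤-trans (≤-reflexive (sym (∑-+ K (pairWeight A) (pairWeight B)))) (∑-≤-length K 44 sparse))))) ⟩
              23 * (length K * length K) + (2 * (27 + length K * 44) + 38)
                -- Every other member carries at most 18 + 2 · 13 = 44 with `A` and `B` together,
                -- against 46 allowed; doubled, this leaves 4 for each.
                ≤⟨ m≤m+n _ (4 * length K) ⟩
              23 * (length K * length K) + (2 * (27 + length K * 44) + 38) + 4 * length K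
                ≡⟨ square (length K) ⟩
              23 * (suc (suc (length K)) * suc (suc (length K)))
                ≡⟨ cong (λ l → 23 * (suc l * suc l)) l≡ ⟨
              23 * (suc (length L) * suc (length L)) ∎
              where
              K≤k : length K ≤ k
              K≤k = ≤-trans (n≤1+n (length K)) (subst (_≤ k) l≡ ≤k)
              sparse : ∀ {C} → C ∈ₗ K → pairWeight A C + pairWeight B C ≤ 44
              sparse {C} i = begin
                pairWeight A C + pairWeight B C
                  ≤⟨ +-mono-≤ (pairWeight≤ A∈S C∈S (All.lookup A∉K i)) (pairWeight≤ B∈S C∈S (All.lookup B∉K i)) ⟩
                (9 + 2 * slots A C) + (9 + 2 * slots B C)
                  ≡⟨ collect (slots A C) (slots B C) ⟩
                18 + 2 * (slots A C + slots B C)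
                  ≤⟨ +-monoʳ-≤ 18 (*-monoʳ-≤ 2 (full⇒sparse A∈S B∈S C∈S A≢B (All.lookup A∉K i) (All.lookup B∉K i) full)) ⟩
                44 ∎
                where
                C∈S = All.lookup K⊆S i
                collect : ∀ s t → (9 + 2 * s) + (9 + 2 * t) ≡ 18 + 2 * (s + t)
                collect = solve-∀
              regroup : ∀ w x y t l → 2 * ((w + x) + (y + t)) + 19 * suc (suc l) ≡ (2 * t + 19 * l) + (2 * (w + (x + y)) + 38)
              regroup = solve-∀
              square : ∀ l → 23 * (l * l) + (2 * (27 + l * 44) + 38) + 4 * l ≡ 23 * (suc (suc l) * suc (suc l))
              square = solve-∀

      -- The square of a sum expanded, where each summand is 0 or 1 and so equals its own square.
      pairSum-square : ∀ L → (∀ {A} → A ∈ₗ L → A # e ≤ 1) → 2 * pairSum L e + ∑ L (_# e) ≡ ∑ L (_# e) * ∑ L (_# e)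
      pairSum-square []      _ = refl
      pairSum-square {e} (A ∷ L) h with A # e | h (here refl)
      ... | 0           | _ = pairSum-square L (h ∘ there)
      ... | 1           | _ = trans (regroup (∑ L (_# e)) (pairSum L e))
                                (trans (cong (λ t → t + (2 * ∑ L (_# e) + 1)) (pairSum-square L (h ∘ there))) (square (∑ L (_# e))))
        where
        regroup : ∀ m p → 2 * (1 * m + p) + (1 + m) ≡ (2 * p + m) + (2 * m + 1)
        regroup = solve-∀
        square : ∀ m → m * m + (2 * m + 1) ≡ (1 + m) * (1 + m)
        square = solve-∀
      ... | suc (suc _) | s≤s ()

      -- Counting all edges.

      crossings : Subset n → ℕ
      crossings e = ∑[ p ← B ] χ e (proj₂ p)

      copies : Subset n → ℕ
      copies e = ∑[ A ← S ] 𝟙 (e ≟ˢ A)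

      -- An edge contains a chosen vertex, is a light member, or has 1, 2 or 3 light vertices, 0
      -- being excluded by `avoiding⇒weight≢0`. With 2 or 3 of them its weighted pair sum is 3 · 1
      -- or 1 · 3, whence the common scale 6 with coefficient 2 on that term.
      edge-counted : e ∈ₗ F →
        6 ≤ 6 * crossings e + (6 * copies e + (6 * 𝟙 (single? e) + 2 * (factor e * pairSum S e)))
      edge-counted {e} e∈F = cases (avoiding? e) (Any.any? (e ≟ˢ_) S)
        where
        open ≤-Reasoning
        cr = crossings e
        cp = copies e
        sg = 𝟙 (single? e)
        pw = factor e * pairSum S e
        Goal = 6 ≤ 6 * cr + (6 * cp + (6 * sg + 2 * pw))
        by-c : 1 ≤ cr → Goal
        by-c h = ≤-trans (*-monoʳ-≤ 6 h) (m≤m+n (6 * cr) _)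
        by-d : 1 ≤ cp → Goal
        by-d h = ≤-trans (*-monoʳ-≤ 6 h) (≤-trans (m≤m+n (6 * cp) _) (m≤n+m _ (6 * cr)))
        by-s : 1 ≤ sg → Goal
        by-s h = ≤-trans (*-monoʳ-≤ 6 h) (≤-trans (m≤m+n (6 * sg) (2 * pw)) (≤-trans (m≤n+m _ (6 * cp)) (m≤n+m _ (6 * cr))))
        by-t : 3 ≤ pw → Goal
        by-t h = ≤-trans (*-monoʳ-≤ 2 h) (≤-trans (m≤n+m (2 * pw) (6 * sg)) (≤-trans (m≤n+m _ (6 * cp)) (m≤n+m _ (6 * cr))))
        weighed : Avoiding e → e ∉ₗ S → ∀ m → weight e ≡ m → m ≤ 3 → Goal
        weighed av e∉S 0 w _ = contradiction w (avoiding⇒weight≢0 e∈F av)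
        weighed av e∉S 1 w _ = by-s (≤-reflexive (sym (𝟙-yes (single? e) (av , w))))
        weighed av e∉S (suc (suc m)) w m≤3 = by-t (begin
          3                              ≤⟨ value m m≤3 (pairSum S e) (subst (λ w → 2 * pairSum S e + w ≡ w * w) w (pairSum-square S at-most-1)) ⟩
          level (2 + m) * pairSum S e    ≡⟨ cong (_* pairSum S e) (*-identityˡ (level (2 + m))) ⟨
          1 * level (2 + m) * pairSum S e ≡⟨ cong₂ (λ f w → f * level w * pairSum S e) (𝟙-yes (avoiding? e) av) w ⟨
          pw                             ∎)
          where
          at-most-1 : ∀ {A} → A ∈ₗ S → A # e ≤ 1
          at-most-1 {A} i = ≤-trans (≤-reflexive (#≡∣∩∣ A e)) (∩≤1 (All.lookup M⊆F (S⊆M i)) e∈F λ { refl → e∉S i })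
          value : ∀ m → 2 + m ≤ 3 → ∀ p → 2 * p + (2 + m) ≡ (2 + m) * (2 + m) → 3 ≤ level (2 + m) * p
          value 0 _ p eq = ≤-reflexive (cong (3 *_) (sym (*-cancelˡ-≡ p 1 2 (+-cancelʳ-≡ 2 (2 * p) 2 eq))))
          value 1 _ p eq = ≤-reflexive (cong (1 *_) (sym (*-cancelˡ-≡ p 3 2 (+-cancelʳ-≡ 3 (2 * p) 6 eq))))
          value (suc (suc m)) (s≤s (s≤s (s≤s ())))
        cases : Dec (Avoiding e) → Dec (e ∈ₗ S) → Goal
        cases (no ¬av) _ = crossing (find (¬All⇒Any¬ (λ p → ¬? (proj₂ p ∈? e)) B ¬av))
          where
          crossing : (∃ λ p → p ∈ₗ B × ¬ (proj₂ p ∉ e)) → Goal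
          crossing (p , p∈B , ¬∉) = by-c (≤-trans
            (≤-reflexive (sym (𝟙-yes (proj₂ p ∈? e) (decidable-stable (proj₂ p ∈? e) ¬∉)))) (term≤∑ (λ p → χ e (proj₂ p)) p∈B))
        cases (yes _)  (yes e∈S) = by-d (≤-trans (≤-reflexive (sym (𝟙-yes (e ≟ˢ e) refl))) (term≤∑ (λ A → 𝟙 (e ≟ˢ A)) e∈S))
        cases (yes av) (no e∉S)  = weighed av e∉S (weight e) refl (≤-trans (m≤n+m (weight e) (rest e)) (rest+weight≤3 e∈F))

      singles-total : ∑[ e ← F ] 𝟙 (single? e) ≤ length S * (6 + length B * 2)
      singles-total = begin
        ∑[ e ← F ] 𝟙 (single? e)
          ≤⟨ ∑-mono F (λ {e} _ → 𝟙-≤ (single? e) (found e)) ⟩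
        ∑[ e ← F ] ∑[ A ← S ] ∑[ a ← elems A ] 𝟙 (single? e ×-dec a ∈? e)
          ≡⟨ ∑-swap F S (λ e A → ∑[ a ← elems A ] 𝟙 (single? e ×-dec a ∈? e)) ⟩
        ∑[ A ← S ] ∑[ e ← F ] ∑[ a ← elems A ] 𝟙 (single? e ×-dec a ∈? e)
          ≤⟨ ∑-≤-length S (6 + length B * 2) (λ {A} i →
               ≤-trans (≤-reflexive (∑-swap F (elems A) (λ e a → 𝟙 (single? e ×-dec a ∈? e)))) (singles≤ i)) ⟩
        length S * (6 + length B * 2) ∎
        where
        open ≤-Reasoning
        found : ∀ e → Single e → 1 ≤ ∑[ A ← S ] ∑[ a ← elems A ] 𝟙 (single? e ×-dec a ∈? e)
        found e se with ∑-pos S (_# e) (≤-reflexive (sym (proj₂ se)))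
        ... | A , A∈S , p with ∑-pos (elems A) (χ e) p
        ... | a , a∈A , q = begin
          1                                               ≡⟨ 𝟙-yes (single? e ×-dec a ∈? e) (se , 𝟙-true (a ∈? e) q) ⟨
          𝟙 (single? e ×-dec a ∈? e)                      ≤⟨ term≤∑ (λ a → 𝟙 (single? e ×-dec a ∈? e)) a∈A ⟩
          ∑[ a ← elems A ] 𝟙 (single? e ×-dec a ∈? e)     ≤⟨ term≤∑ (λ A → ∑[ a ← elems A ] 𝟙 (single? e ×-dec a ∈? e)) A∈S ⟩
          ∑[ A ← S ] ∑[ a ← elems A ] 𝟙 (single? e ×-dec a ∈? e) ∎

      edges≤ : ∀ Δ → (∀ x → degree F x ≤ Δ) →
               6 * length F ≤ 6 * (length B * Δ) + (6 * length S + (6 * (length S * (6 + length B * 2)) + 2 * totalWeight S))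
      edges≤ Δ deg≤ = begin
        6 * length F
          ≡⟨ trans (cong (6 *_) (sym (∑-1 F))) (sym (∑-*ˡ F 6 (λ _ → 1))) ⟩
        ∑[ _ ← F ] 6
          ≤⟨ ∑-mono F edge-counted ⟩
        ∑[ e ← F ] (6 * crossings e + (6 * copies e + (6 * 𝟙 (single? e) + 2 * (factor e * pairSum S e))))
          ≡⟨ separate ⟩
        6 * ∑ F crossings + (6 * ∑ F copies + (6 * ∑[ e ← F ] 𝟙 (single? e) + 2 * totalWeight S))
          ≤⟨ +-mono-≤ (*-monoʳ-≤ 6 crossings≤) (+-mono-≤ (*-monoʳ-≤ 6 copies≤) (+-monoˡ-≤ (2 * totalWeight S) (*-monoʳ-≤ 6 singles-total))) ⟩
        6 * (length B * Δ) + (6 * length S + (6 * (length S * (6 + length B * 2)) + 2 * totalWeight S)) ∎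
        where
        open ≤-Reasoning
        separate : ∑[ e ← F ] (6 * crossings e + (6 * copies e + (6 * 𝟙 (single? e) + 2 * (factor e * pairSum S e))))
                   ≡ 6 * ∑ F crossings + (6 * ∑ F copies + (6 * ∑[ e ← F ] 𝟙 (single? e) + 2 * totalWeight S))
        separate =
          trans (∑-+ F (λ e → 6 * crossings e) (λ e → 6 * copies e + (6 * 𝟙 (single? e) + 2 * (factor e * pairSum S e))))
            (cong₂ _+_ (∑-*ˡ F 6 crossings)
              (trans (∑-+ F (λ e → 6 * copies e) (λ e → 6 * 𝟙 (single? e) + 2 * (factor e * pairSum S e)))
                (cong₂ _+_ (∑-*ˡ F 6 copies)
                  (trans (∑-+ F (λ e → 6 * 𝟙 (single? e)) (λ e → 2 * (factor e * pairSum S e)))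
                    (cong₂ _+_ (∑-*ˡ F 6 (λ e → 𝟙 (single? e))) (∑-*ˡ F 2 (λ e → factor e * pairSum S e)))))))
        crossings≤ : ∑ F crossings ≤ length B * Δ
        crossings≤ = ≤-trans (≤-reflexive (∑-swap F B (λ e p → χ e (proj₂ p)))) (∑-≤-length B Δ (λ {p} _ →
          ≤-trans (≤-reflexive (sym (length-filter-∑ (proj₂ p ∈?_) F))) (deg≤ (proj₂ p))))
        copies≤ : ∑ F copies ≤ length S
        copies≤ = ≤-trans (≤-reflexive (∑-swap F S (λ e A → 𝟙 (e ≟ˢ A))))
          (≤-trans (∑-≤-length S 1 (λ {A} _ → count≡≤1 _≟ˢ_ F-unique A)) (≤-reflexive (*-identityʳ (length S))))

      -- Heavy members are charged Δ each, so 6Δ has to cover the share of one light member. Adding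
      -- `19 * s` to both sides makes `totalWeight≤` applicable; the linear terms 6 + 36 = 42 then
      -- match 23 + 19 exactly.
      size-bound : ∀ Δ → (∀ x → degree F x ≤ Δ) → 23 * (length B + length S) + 23 ≤ 6 * Δ →
                   length F ≤ Δ * (length B + length S)
      size-bound Δ deg≤ large = *-cancelˡ-≤ 6 (+-cancelʳ-≤ (19 * s) (6 * length F) (6 * (Δ * (t + s))) (begin
        6 * length F + 19 * s
          ≤⟨ +-monoˡ-≤ (19 * s) (edges≤ Δ deg≤) ⟩
        6 * (t * Δ) + (6 * s + (6 * (s * (6 + t * 2)) + 2 * totalWeight S)) + 19 * s
          ≡⟨ regroup t s Δ (totalWeight S) ⟩
        6 * (t * Δ) + (42 * s + 12 * (s * t)) + (2 * totalWeight S + 19 * s)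
          ≤⟨ +-monoʳ-≤ (6 * (t * Δ) + (42 * s + 12 * (s * t)))
               (totalWeight≤ s S ≤-refl S-unique (All.tabulate (λ i → i))) ⟩
        6 * (t * Δ) + (42 * s + 12 * (s * t)) + 23 * (s * s)
          -- The mixed term is 12 per heavy and light member, while the hypothesis on `Δ` allows 23.
          ≤⟨ m≤m+n _ (11 * (s * t)) ⟩
        6 * (t * Δ) + (42 * s + 12 * (s * t)) + 23 * (s * s) + 11 * (s * t)
          ≡⟨ collect t s Δ ⟩
        6 * (t * Δ) + s * (23 * (t + s) + 23) + 19 * s
          ≤⟨ +-monoˡ-≤ (19 * s) (+-monoʳ-≤ (6 * (t * Δ)) (*-monoʳ-≤ s large)) ⟩
        6 * (t * Δ) + s * (6 * Δ) + 19 * s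
          ≡⟨ cong (_+ 19 * s) (factorise t s Δ) ⟩
        6 * (Δ * (t + s)) + 19 * s ∎))
        where
        open ≤-Reasoning
        t = length B
        s = length S
        regroup : ∀ t s Δ w → 6 * (t * Δ) + (6 * s + (6 * (s * (6 + t * 2)) + 2 * w)) + 19 * s
                              ≡ 6 * (t * Δ) + (42 * s + 12 * (s * t)) + (2 * w + 19 * s)
        regroup = solve-∀
        collect : ∀ t s Δ → 6 * (t * Δ) + (42 * s + 12 * (s * t)) + 23 * (s * s) + 11 * (s * t)
                            ≡ 6 * (t * Δ) + s * (23 * (t + s) + 23) + 19 * s
        collect = solve-∀
        factorise : ∀ t s Δ → 6 * (t * Δ) + s * (6 * Δ) ≡ 6 * (Δ * (t + s))
        factorise = solve-∀

-- The degree hypothesis and the conclusion.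

-- Since ν² = (ν + 1)(ν - 1) + 1, the reverse inequality multiplied by ν - 1 would stay below 23ν².
degree-large : ∀ ν Δ → 2 ≤ ν → 23 * (ν * ν) ≤ 6 * (Δ * (ν ∸ 1)) → 23 * ν + 23 ≤ 6 * Δ
degree-large (suc (suc k)) Δ _ h = ≮⇒≥ λ small → <⇒≱ (begin-strict
  6 * (Δ * suc k)                              ≡⟨ *-assoc 6 Δ (suc k) ⟨
  6 * Δ * suc k                                ≤⟨ *-monoˡ-≤ (suc k) (<⇒≤ small) ⟩
  (23 * suc (suc k) + 23) * suc k              <⟨ m<m+n _ (s≤s z≤n) ⟩
  (23 * suc (suc k) + 23) * suc k + 23         ≡⟨ square k ⟩
  23 * (suc (suc k) * suc (suc k))             ∎) h
  where
  open ≤-Reasoning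
  square : ∀ k → (23 * suc (suc k) + 23) * suc k + 23 ≡ 23 * (suc (suc k) * suc (suc k))
  square = solve-∀
degree-large (suc zero) _ (s≤s ()) _

theorem2 : ∀ (n : ℕ) (F : SetSystem n) (ν Δ : ℕ) →
    IsSetSystem F → ThreeUniform F → Linear F →
    IsMatchingNumber F ν → IsMaxDegree F Δ →
    2 ≤ ν →
    -- Δ ≥ (23/6) ν (1 + 1/(ν-1))  ⇔  23 ν² ≤ 6 Δ (ν - 1)   (as ν ≥ 2)
    23 * (ν * ν) ≤ 6 * (Δ * (ν ∸ 1)) →
    length F ≤ Δ * ν
theorem2 n F ν Δ unique uniform linear ((M , (_ , M⊆F , M-disjoint) , ∣M∣≡ν) , maximum) (degree≤ , _) 2≤ν large =
  let B , S , p , heavy , light = partition M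
      ν≡ : length B + length S ≡ ν
      ν≡ = trans (trans (cong (_+ length S) (sym (length-map proj₁ B))) (sym (length-++ (map proj₁ B))))
                 (trans (sym (↭-length p)) ∣M∣≡ν)
  in subst (λ ν → length F ≤ Δ * ν) ν≡
       (Extremal.size-bound B S (All-resp-↭ p M⊆F)
         (allPairs-↭ (λ {A} {C} d {x} → disjoint-sym {A = A} {C} d {x}) p
           (AllPairs.map (λ {A} {C} ∅ {x} → empty⇒disjoint {A = A} {C} ∅ {x}) M-disjoint))
         (Any-resp-↭ p) (λ i j → Any-resp-↭ (↭-sym p) (lose i j)) heavy light
         (λ Q Q⊆F Q-disjoint → subst (length Q ≤_) (sym ν≡) (maximum Q (matching Q⊆F Q-disjoint)))
         Δ degree≤ (subst (λ ν → 23 * ν + 23 ≤ 6 * Δ) (sym ν≡) (degree-large ν Δ 2≤ν large)))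
  where
  open Linear3Graph F unique uniform linear
  open Partitioned (λ v → Any (v ∈_) M) (λ v → Any.any? (v ∈?_) M)
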